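{- Let $G$ be a 2-connected claw-o-heavy graph of order $n$. If for every induced path $v_1v_2v_3v_4v_5v_6$ on six vertices in $G$ there exist $i\in\{1,2,3\}$ and $j\in\{4,5,6\}$ with $d(v_i)+d(v_j)\geq n$, then $G$ is hamiltonian.
   Context: Graphs are finite, simple and undirected; $d(v)$ is the degree of $v$ in $G$. A graph $G$ on $n$ vertices is claw-o-heavy if every induced subgraph of $G$ isomorphic to $K_{1,3}$ contains two nonadjacent vertices $u,v$ with $d(u)+d(v)\geq n$. An induced path $v_1\cdots v_6$ means an induced subgraph isomorphic to $P_6$ with edges $v_kv_{k+1}$. -}

module Defs where

open import Data.Nat using (ℕ; zero; suc; _+_; _≤_; _<_)
open import Data.Fin using (Fin; toℕ)
open import Data.Bool using (Bool; true; false; if_then_else_; T)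
open import Data.List using (List; []; _∷_; _++_; [_]; allFin; map; length)
open import Data.Nat.ListAction using (sum)
open import Data.List.Membership.Propositional using (_∈_)
open import Data.List.Relation.Unary.All using (All)
open import Data.List.Relation.Unary.Unique.Propositional using (Unique)
open import Data.Product using (Σ; ∃; _×_; _,_)
open import Data.Sum using (_⊎_)
open import Data.Empty using (⊥)
open import Relation.Nullary using (¬_)
open import Relation.Binary.PropositionalEquality using (_≡_; _≢_)
open import Function.Definitions using (Injective)
open import Function.Bundles using (_⇔_)

record Graph (n : ℕ) : Set where
  field
    adj   : Fin n → Fin n → Bool
    sym   : ∀ u v → adj u v ≡ adj v u
    irrefl : ∀ v → adj v v ≡ false

module _ {n : ℕ} (G : Graph n) where
  open Graph G

  Adj : Fin n → Fin n → Set
  Adj u v = T (adj u v)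

  degree : Fin n → ℕ
  degree v = sum (map (λ u → if adj v u then 1 else 0) (allFin n))

  data Walk : List (Fin n) → Set where
    walk-[]  : Walk []
    walk-[_] : ∀ v → Walk (v ∷ [])
    walk-∷   : ∀ {u v vs} → Adj u v → Walk (v ∷ vs) → Walk (u ∷ v ∷ vs)

  WalkAvoiding : Fin n → Fin n → Fin n → Set
  WalkAvoiding x u v =
    Σ (List (Fin n)) λ ws → Walk (u ∷ ws ++ [ v ]) × All (λ w → w ≢ x) (u ∷ ws ++ [ v ])

  Connected : Set
  Connected = ∀ u v → Σ (List (Fin n)) λ ws → Walk (u ∷ ws ++ [ v ])

  TwoConnected : Set
  TwoConnected =
    3 ≤ n × Connected ×
    (∀ x u v → u ≢ x → v ≢ x → WalkAvoiding x u v)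

  InducedClaw : Fin n → Fin n → Fin n → Fin n → Set
  InducedClaw c a₁ a₂ a₃ =
    Adj c a₁ × Adj c a₂ × Adj c a₃ ×
    ¬ Adj a₁ a₂ × ¬ Adj a₁ a₃ × ¬ Adj a₂ a₃ ×
    a₁ ≢ a₂ × a₁ ≢ a₃ × a₂ ≢ a₃

  -- every induced claw has two nonadjacent vertices (necessarily two leaves)
  -- with degree sum ≥ n
  ClawOHeavy : Set
  ClawOHeavy = ∀ c a₁ a₂ a₃ → InducedClaw c a₁ a₂ a₃ →
    (n ≤ degree a₁ + degree a₂) ⊎ (n ≤ degree a₁ + degree a₃) ⊎ (n ≤ degree a₂ + degree a₃)

  -- induced path v₀ v₁ … v₅ (indices shifted by one w.r.t. the paper)
  InducedP6 : (Fin 6 → Fin n) → Set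
  InducedP6 v = Injective _≡_ _≡_ v ×
    (∀ i j → Adj (v i) (v j) ⇔ (toℕ j ≡ suc (toℕ i) ⊎ toℕ i ≡ suc (toℕ j)))

  Hamiltonian : Set
  Hamiltonian = Σ (Fin n) λ x → Σ (List (Fin n)) λ xs →
    3 ≤ length (x ∷ xs) × Unique (x ∷ xs) × (∀ v → v ∈ x ∷ xs) ×
    Walk (x ∷ xs ++ [ x ])

{-# OPTIONS --safe #-}
-- Write u ≈ v if uv is an edge or d(u) + d(v) ≥ n, and call v heavy if 2d(v) ≥ n; heavy vertices
-- are pairwise ≈.  Take an ≈-cycle C through all heavy vertices of maximal length; the
-- Bondy–Chvátal exchange turns it into a cycle of G.  If C misses a vertex, 2-connectedness yields
-- a shortest path P outside C joining two vertices x₁ and x₂ of C, so that C = x₁ S₁ x₂ S₂.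
-- By claws at x₁ and x₂, the predecessor and successor of xᵢ on C are ≈-related; hence x₁ can be
-- moved along C next to any of its ≈-neighbours, and each such move forbids ≈-relations.  With
-- x₁ w₁ and w₁ y₁ edges on the S₁ side, y₁ not adjacent to x₁, and w₂, y₂ likewise for x₂, six
-- consecutive vertices of y₁ w₁ x₁ P x₂ w₂ y₂ (or y₁ w₁ x₁ x₂ w₂ y₂) induce a P₆ in which only
-- heaviness of x₁ or d(x₁) + d(x₂) ≥ n can meet the hypothesis; by symmetry d(x₁) + d(x₂) ≥ n.
-- The common neighbours of x₁ and x₂ outside C form an ≈-clique.  Routing C through ω vertices
-- outside shows that on each Sᵢ a passage from an ≈-neighbour of x₁ to one of x₂ skips at least ω
-- vertices related to neither, and none of the skipped vertices is heavy.  Counting the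
-- neighbours of x₁ and x₂ then gives d(x₁) + d(x₂) < n.
module Submission where

open import Defs
open import Data.Bool using (T; true; false; if_then_else_)
open import Data.Bool.Properties using (T?)
open import Data.Empty using (⊥; ⊥-elim)
open import Data.Fin using (Fin; suc; toℕ)
open import Data.Fin.Patterns
open import Data.Fin.Properties using (_≟_; <-cmp; any?; all?; ¬∀⟶∃¬)
open import Data.List using (List; []; _∷_; _++_; [_]; map; length; reverse; filter; allFin)
open import Data.List.Membership.Propositional using (_∈_; _∉_)
open import Data.List.Membership.Propositional.Properties
  using (∈-∃++; ∈-++⁺ˡ; ∈-++⁺ʳ; ∈-++⁻; ∈-allFin; ∈-filter⁺; ∈-filter⁻)
open import Data.List.Properties
  using (++-assoc; ++-identityʳ; unfold-reverse; length-++; length-reverse; length-tabulate; map-++;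
         filter-accept; filter-reject)
open import Data.List.Relation.Binary.Permutation.Propositional
  using (_↭_; ↭-refl; ↭-reflexive; ↭-sym; ↭-trans; prep; ↭⇒↭ₛ)
open import Data.List.Relation.Binary.Permutation.Propositional.Properties
  using (++-comm; shift; shifts; ∈-resp-↭; ↭-length; map⁺; ++⁺; ++⁺ˡ; ++⁺ʳ; ↭-reverse; ++-commutativeMonoid)
import Data.List.Relation.Binary.Permutation.Setoid.Properties as Setoid↭
open import Data.List.Relation.Unary.All as All using (All; []; _∷_)
import Data.List.Relation.Unary.All.Properties as All
open import Data.List.Relation.Unary.AllPairs using ([]; _∷_)
open import Data.List.Relation.Unary.Any using (here; there)
open import Data.List.Relation.Unary.Any.Properties using (¬Any[])
open import Data.List.Relation.Unary.Unique.Propositional using (Unique)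
import Data.List.Relation.Unary.Unique.Propositional.Properties as Unique⁺
open Unique⁺ using (Unique[x∷xs]⇒x∉xs; allFin⁺; filter⁺)
open import Data.Nat as ℕ using (ℕ; zero; suc; _+_; _∸_; _≤_; _<_; z≤n; s≤s; _≤?_)
open import Data.Nat.Induction using (<-wellFounded)
open import Data.Nat.ListAction using (sum)
open import Data.Nat.ListAction.Properties using (sum-++; sum-↭)
open import Data.Nat.Properties hiding (_≟_; <-cmp)
open import Data.Nat.Tactic.RingSolver using (solve-∀)
open import Data.Product using (Σ; ∃; _×_; _,_; proj₁; proj₂)
open import Data.Sum as Sum using (_⊎_; inj₁; inj₂)
open import Data.Vec using ([]; _∷_; lookup)
open import Function.Bundles using (_⇔_; mk⇔; Equivalence)
open import Function.Definitions using (Injective)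
open import Induction.WellFounded using (Acc; acc)
open import Relation.Binary.Definitions using (Symmetric; tri<; tri≈; tri>)
open import Relation.Binary.PropositionalEquality hiding ([_])
open import Relation.Binary.PropositionalEquality.Properties using (setoid)
open import Relation.Nullary using (¬_; Dec; yes; no)
open import Relation.Nullary.Decidable
  using (does; from-yes; map′; ¬?; _×-dec_; _⊎-dec_; _→-dec_; decidable-stable)
open import Relation.Unary using (Decidable)
import Algebra.Solver.CommutativeMonoid as CommutativeMonoidSolver

-- Paths and lists

-- The list holds both end vertices, so joining two paths by a step concatenates their lists, and
-- vertex sets can be compared by permutations of lists.
data Path {A : Set} (R : A → A → Set) : A → List A → A → Set where
  stop : ∀ a → Path R a [ a ] a
  _∷_  : ∀ {a b l c} → R a b → Path R b l c → Path R a (a ∷ l) c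

module _ {A : Set} {R : A → A → Set} where

  infixr 5 _++⟨_⟩_

  _++⟨_⟩_ : ∀ {a l b c m d} → Path R a l b → R b c → Path R c m d → Path R a (l ++ m) d
  stop a  ++⟨ r ⟩ q = r ∷ q
  (s ∷ p) ++⟨ r ⟩ q = s ∷ (p ++⟨ r ⟩ q)

  reversePath : Symmetric R → ∀ {a l b} → Path R a l b → Path R b (reverse l) a
  reversePath s (stop a) = stop a
  reversePath s (_∷_ {a} {l = l} r p) =
    subst (λ k → Path R _ k a) (sym (unfold-reverse a l)) (reversePath s p ++⟨ s r ⟩ stop a)

  mapPath : ∀ {S : A → A → Set} → (∀ {u v} → R u v → S u v) → ∀ {a l b} → Path R a l b → Path S a l b
  mapPath f (stop a) = stop a
  mapPath f (r ∷ p)  = f r ∷ mapPath f p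

  splitPath : ∀ {a b x} xs {y ys} → Path R a (x ∷ xs ++ y ∷ ys) b →
              ∃ λ c → Path R a (x ∷ xs) c × R c y × Path R y (y ∷ ys) b
  splitPath []       (r ∷ p@(stop _)) = _ , stop _ , r , p
  splitPath []       (r ∷ p@(_ ∷ _))  = _ , stop _ , r , p
  splitPath (x ∷ xs) (r ∷ p) with splitPath xs p
  ... | c , p₁ , s , p₂ = c , r ∷ p₁ , s , p₂

  prefixPath : ∀ {a b} xs {y ys} → Path R a (xs ++ y ∷ ys) b → Path R a (xs ++ [ y ]) y
  prefixPath []       (stop _) = stop _
  prefixPath []       (_ ∷ _)  = stop _
  prefixPath (x ∷ []) (r ∷ p)  = r ∷ prefixPath [] p
  prefixPath (x ∷ xs@(_ ∷ _)) (r ∷ p) = r ∷ prefixPath xs p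

  suffixPath : ∀ {a b} xs {y ys} → Path R a (xs ++ y ∷ ys) b → Path R y (y ∷ ys) b
  suffixPath []       p@(stop _) = p
  suffixPath []       p@(_ ∷ _)  = p
  suffixPath (x ∷ []) (r ∷ p)    = suffixPath [] p
  suffixPath (x ∷ xs@(_ ∷ _)) (r ∷ p) = suffixPath xs p

  lastOf : ∀ {a l b} → Path R a l b → ∃ λ k → l ≡ k ++ [ b ]
  lastOf (stop a) = [] , refl
  lastOf (_∷_ {a} r p) with lastOf p
  ... | k , eq = a ∷ k , cong (a ∷_) eq

  headOf : ∀ {a l b} → Path R a l b → ∃ λ k → l ≡ a ∷ k
  headOf (stop a) = [] , refl
  headOf (_ ∷ _)  = _ , refl

-- The empty list is allowed for a piece of an arc at its very end, where the cycle vertex bounding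
-- the arc takes the place of a related vertex.
data EndsIn {A : Set} (P : A → Set) : List A → Set where
  []   : EndsIn P []
  snoc : ∀ l {v} → P v → EndsIn P (l ++ [ v ])

data StartsIn {A : Set} (P : A → Set) : List A → Set where
  []   : StartsIn P []
  cons : ∀ {v} → P v → ∀ l → StartsIn P (v ∷ l)

-- S is read as a word over four letters: vertices related to the left end (A), to the right
-- end (B), to both, or to neither.  Passing from an A to a later B costs ω free letters.
module Gaps {V : Set} {A B : V → Set} (A? : Decidable A) (B? : Decidable B) (γ : V → ℕ)
  (γ≤2 : ∀ v → γ v ≤ 2) (¬A⇒γ≤1 : ∀ {v} → ¬ A v → γ v ≤ 1) (¬B⇒γ≤1 : ∀ {v} → ¬ B v → γ v ≤ 1)
  (free⇒γ≤0 : ∀ {v} → ¬ A v → ¬ B v → γ v ≤ 0)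
  {S : List V} {ω : ℕ} (ω>0 : 0 < ω)
  (gap : ∀ U M W → S ≡ U ++ M ++ W → EndsIn A U → StartsIn B W →
         All (λ v → ¬ A v × ¬ B v) M → ω ≤ length M)
  where

  weight : List V → ℕ
  weight T = sum (map γ T)

  private
    snoc-≡ : ∀ U M {v} T → S ≡ U ++ M ++ v ∷ T → S ≡ ((U ++ M) ++ [ v ]) ++ T
    snoc-≡ U M {v} T eq = trans eq (trans (sym (++-assoc U M _)) (sym (++-assoc (U ++ M) [ v ] T)))

  -- Invariants of a scan from left to right. In the state `afterA` the last letter that is not free
  -- was an A, so ω is still owed, and the free letters `M` read since then are saved to pay it. In
  -- the state `afterB` nothing is owed.
  afterA : ∀ U M T → S ≡ U ++ M ++ T → EndsIn A U → All (λ v → ¬ A v × ¬ B v) M →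
           weight T + ω ≤ length M + length T
  afterB : ∀ U T → S ≡ U ++ T → weight T ≤ length T

  afterA U M [] eq e f = ≤-trans (gap U M [] eq e [] f) (m≤m+n _ 0)
  afterA U M (v ∷ T) eq e f with A? v | B? v
  ... | yes a | yes b = begin
      γ v + weight T + ω     ≡⟨ +-assoc (γ v) _ _ ⟩
      γ v + (weight T + ω)   ≤⟨ +-mono-≤ (γ≤2 v) (afterA _ [] T (snoc-≡ U M T eq) (snoc (U ++ M) a) []) ⟩
      2 + length T           ≤⟨ +-monoˡ-≤ (suc (length T)) (≤-trans ω>0 (gap U M (v ∷ T) eq e (cons b T) f)) ⟩
      length M + suc (length T) ∎
    where open ≤-Reasoning
  ... | yes a | no ¬b = begin
      γ v + weight T + ω     ≡⟨ +-assoc (γ v) _ _ ⟩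
      γ v + (weight T + ω)   ≤⟨ +-mono-≤ (¬B⇒γ≤1 ¬b) (afterA _ [] T (snoc-≡ U M T eq) (snoc (U ++ M) a) []) ⟩
      1 + length T           ≤⟨ m≤n+m _ (length M) ⟩
      length M + suc (length T) ∎
    where open ≤-Reasoning
  ... | no ¬a | yes b = begin
      γ v + weight T + ω     ≤⟨ +-monoˡ-≤ ω (+-mono-≤ (¬A⇒γ≤1 ¬a) (afterB _ T (snoc-≡ U M T eq))) ⟩
      suc (length T) + ω     ≡⟨ +-comm (suc (length T)) ω ⟩
      ω + suc (length T)     ≤⟨ +-monoˡ-≤ _ (gap U M (v ∷ T) eq e (cons b T) f) ⟩
      length M + suc (length T) ∎
    where open ≤-Reasoning
  ... | no ¬a | no ¬b = begin
      γ v + weight T + ω     ≤⟨ +-monoˡ-≤ ω (+-monoˡ-≤ (weight T) (free⇒γ≤0 ¬a ¬b)) ⟩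
      weight T + ω           ≤⟨ afterA U (M ++ [ v ]) T
                                  (trans eq (cong (U ++_) (sym (++-assoc M [ v ] T)))) e
                                  (All.++⁺ f ((¬a , ¬b) ∷ [])) ⟩
      length (M ++ [ v ]) + length T ≡⟨ cong (_+ length T) (length-++ M) ⟩
      length M + 1 + length T ≡⟨ +-assoc (length M) 1 _ ⟩
      length M + suc (length T) ∎
    where open ≤-Reasoning

  afterB U [] eq = z≤n
  afterB U (v ∷ T) eq with A? v
  ... | yes a = begin
      γ v + weight T       ≤⟨ +-monoˡ-≤ (weight T) (γ≤2 v) ⟩
      2 + weight T         ≡⟨ cong suc (+-comm 1 (weight T)) ⟩
      -- The letter may weigh 2; one unit of the ω owed after it covers the surplus.
      suc (weight T + 1)   ≤⟨ s≤s (+-monoʳ-≤ (weight T) ω>0) ⟩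
      suc (weight T + ω)   ≤⟨ s≤s (afterA _ [] T (trans eq (sym (++-assoc U [ v ] T))) (snoc U a) []) ⟩
      suc (length T) ∎
    where open ≤-Reasoning
  ... | no ¬a = +-mono-≤ (¬A⇒γ≤1 ¬a) (afterB _ T (trans eq (sym (++-assoc U [ v ] T))))

  -- The left end of `S` counts as an A and its right end as a B, so ω is paid at least once.
  weight-bound : weight S + ω ≤ length S
  weight-bound = afterA [] [] S refl [] []

-- Lists without repetition

module _ {A : Set} where

  Unique-↭ : {xs ys : List A} → xs ↭ ys → Unique xs → Unique ys
  Unique-↭ p = Setoid↭.Unique-resp-↭ (setoid A) (↭⇒↭ₛ p)

  Unique-++⁻ʳ : ∀ (xs : List A) {ys} → Unique (xs ++ ys) → Unique ys
  Unique-++⁻ʳ []       u       = u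
  Unique-++⁻ʳ (x ∷ xs) (_ ∷ u) = Unique-++⁻ʳ xs u

  Unique-++⁻ˡ : ∀ (xs : List A) {ys} → Unique (xs ++ ys) → Unique xs
  Unique-++⁻ˡ xs {ys} u = Unique-++⁻ʳ ys (Unique-↭ (++-comm xs ys) u)

  Unique-disjoint : ∀ (xs : List A) {ys v} → Unique (xs ++ ys) → v ∈ xs → v ∉ ys
  Unique-disjoint (x ∷ xs) u@(_ ∷ _) (here refl) j = Unique[x∷xs]⇒x∉xs u (∈-++⁺ʳ xs j)
  Unique-disjoint (x ∷ xs) (_ ∷ u)   (there i)   j = Unique-disjoint xs u i j

  Unique-⊆-↭ : ∀ {xs ys : List A} → Unique xs → (∀ {v} → v ∈ xs → v ∈ ys) → ∃ λ zs → ys ↭ xs ++ zs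
  Unique-⊆-↭ {[]}     {ys} _ _ = ys , ↭-refl
  Unique-⊆-↭ {x ∷ xs} {ys} u@(_ ∷ u′) s with ∈-∃++ (s (here refl))
  ... | ps , qs , refl =
      let zs , r = Unique-⊆-↭ u′ sub in zs , ↭-trans (shift x ps qs) (prep x r)
    where
    sub : ∀ {v} → v ∈ xs → v ∈ ps ++ qs
    sub i with ∈-resp-↭ (shift x ps qs) (s (there i))
    ... | here refl = ⊥-elim (Unique[x∷xs]⇒x∉xs u i)
    ... | there j   = j

  clique-path : {R : A → A → Set} → ∀ {v l} → Unique (v ∷ l) →
                (∀ {a b} → a ∈ v ∷ l → b ∈ v ∷ l → a ≢ b → R a b) → ∃ λ w → Path R v (v ∷ l) w
  clique-path {l = []}    u r = _ , stop _
  clique-path {l = _ ∷ _} ((v≢b ∷ _) ∷ u) r =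
    let w , p = clique-path u (λ i j → r (there i) (there j))
    in w , r (here refl) (there (here refl)) v≢b ∷ p

module _ {n : ℕ} where

  length-allFin : length (allFin n) ≡ n
  length-allFin = length-tabulate _

  complement : ∀ {xs : List (Fin n)} → Unique xs → ∃ λ zs → allFin n ↭ xs ++ zs
  complement u = Unique-⊆-↭ u (λ {v} _ → ∈-allFin v)

  Unique⇒length≤n : ∀ {xs : List (Fin n)} → Unique xs → length xs ≤ n
  Unique⇒length≤n {xs} u with complement u
  ... | zs , p = begin
      length xs              ≤⟨ m≤m+n _ _ ⟩
      length xs + length zs  ≡⟨ length-++ xs ⟨
      length (xs ++ zs)      ≡⟨ ↭-length p ⟨
      length (allFin n)      ≡⟨ length-allFin ⟩
      n ∎
    where open ≤-Reasoning

  search : ∀ k {P : List (Fin n) → Set} → Decidable P → Dec (∃ λ l → length l ≤ k × P l)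
  search zero P? = map′ (λ p → [] , z≤n , p) (λ { ([] , _ , p) → p ; (_ ∷ _ , () , _) }) (P? [])
  search (suc k) {P} P? =
    map′ to from (P? [] ⊎-dec any? (λ x → search k (λ l → P? (x ∷ l))))
    where
    to : P [] ⊎ (∃ λ x → ∃ λ l → length l ≤ k × P (x ∷ l)) → ∃ λ l → length l ≤ suc k × P l
    to (inj₁ p)               = [] , z≤n , p
    to (inj₂ (x , l , b , p)) = x ∷ l , s≤s b , p
    from : (∃ λ l → length l ≤ suc k × P l) → P [] ⊎ (∃ λ x → ∃ λ l → length l ≤ k × P (x ∷ l))
    from ([]    , _     , p) = inj₁ p
    from (x ∷ l , s≤s b , p) = inj₂ (x , l , b , p)

-- Decidability of hamiltonicity, and paths without repetition

module _ {n : ℕ} (G : Graph n) where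
  open Graph G using (adj)
  open import Data.List.Membership.DecPropositional (_≟_ {n}) using (_∈?_)
  open import Data.List.Relation.Unary.Unique.DecPropositional (_≟_ {n}) using (unique?)

  walk? : Decidable (Walk G)
  walk? []          = yes walk-[]
  walk? (v ∷ [])    = yes walk-[ v ]
  walk? (u ∷ v ∷ l) = map′ (λ (a , w) → walk-∷ a w) (λ { (walk-∷ a w) → a , w })
                           (T? (adj u v) ×-dec walk? (v ∷ l))

  -- A list without repetition has at most n entries, so a bounded search decides. This makes the
  -- proof of the theorem by contradiction constructive.
  hamiltonian? : Dec (Hamiltonian G)
  hamiltonian? = map′
    (λ { (x , l , _ , h) → x , l , h })
    (λ { (x , l , h@(_ , u , _)) → x , l , ≤-trans (n≤1+n _) (Unique⇒length≤n u) , h })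
    (any? λ x → search n λ l →
      (3 ≤? length (x ∷ l)) ×-dec unique? (x ∷ l) ×-dec
      all? (λ v → v ∈? (x ∷ l)) ×-dec walk? (x ∷ l ++ [ x ]))

  erase-loops : ∀ {a l b} → Path (Adj G) a l b →
                ∃ λ l′ → Path (Adj G) a l′ b × Unique l′ × (∀ {v} → v ∈ l′ → v ∈ l)
  erase-loops (stop a) = [ a ] , stop a , [] ∷ [] , λ i → i
  erase-loops (_∷_ {a} r p) with erase-loops p
  ... | l′ , p′ , u , s with a ∈? l′
  ...   | no a∉ = a ∷ l′ , r ∷ p′ , All.¬Any⇒All¬ l′ a∉ ∷ u , λ { (here e) → here e ; (there i) → there (s i) }
  ...   | yes a∈ with ∈-∃++ a∈
  ...     | xs , ys , refl = a ∷ ys , suffixPath xs p′ , Unique-++⁻ʳ xs u , λ i → there (s (∈-++⁺ʳ xs i))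

-- Heavy pairs and the Bondy–Chvátal exchange

module Heaviness {n : ℕ} (G : Graph n) where
  open Graph G public using (adj; irrefl) renaming (sym to adj-sym)

  d : Fin n → ℕ
  d = degree G

  infix 4 _~_ _≈_ _~?_ _≈?_

  _~_ _≈_ : Fin n → Fin n → Set
  u ~ v = Adj G u v
  u ≈ v = u ~ v ⊎ n ≤ d u + d v

  Heavy : Fin n → Set
  Heavy v = n ≤ d v + d v

  ~-sym : Symmetric _~_
  ~-sym {u} {v} = subst T (adj-sym u v)

  ~-irrefl : ∀ {v} → ¬ v ~ v
  ~-irrefl {v} = subst T (irrefl v)

  ≈-sym : Symmetric _≈_
  ≈-sym (inj₁ a) = inj₁ (~-sym a)
  ≈-sym {u} {v} (inj₂ h) = inj₂ (subst (n ≤_) (+-comm (d u) (d v)) h)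

  _~?_ : ∀ u v → Dec (u ~ v)
  u ~? v = T? (adj u v)

  _≈?_ : ∀ u v → Dec (u ≈ v)
  u ≈? v = (u ~? v) ⊎-dec (n ≤? d u + d v)

  heavy? : Decidable Heavy
  heavy? v = n ≤? d v + d v

  heavy-end : ∀ u v → n ≤ d u + d v → Heavy u ⊎ Heavy v
  heavy-end u v h with ≤-total (d u) (d v)
  ... | inj₁ u≤v = inj₂ (≤-trans h (+-monoˡ-≤ (d v) u≤v))
  ... | inj₂ v≤u = inj₁ (≤-trans h (+-monoʳ-≤ (d u) v≤u))

  heavy-sum : ∀ u v → Heavy u → Heavy v → n ≤ d u + d v
  heavy-sum u v hu hv with ≤-total (d u) (d v)
  ... | inj₁ u≤v = ≤-trans hu (+-monoʳ-≤ (d u) u≤v)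
  ... | inj₂ v≤u = ≤-trans hv (+-monoˡ-≤ (d v) v≤u)

  ind : Fin n → Fin n → ℕ
  ind u v = if adj u v then 1 else 0

  ind≤1 : ∀ u v → ind u v ≤ 1
  ind≤1 u v with adj u v
  ... | true  = s≤s z≤n
  ... | false = z≤n

  ind≤0 : ∀ {u v} → ¬ u ~ v → ind u v ≤ 0
  ind≤0 {u} {v} h with adj u v
  ... | true  = ⊥-elim (h _)
  ... | false = z≤n

  ind-self : ∀ v → ind v v ≡ 0
  ind-self v rewrite irrefl v = refl

  ind₂≤1 : ∀ {u v w x} → ¬ (u ~ v × w ~ x) → ind u v + ind w x ≤ 1
  ind₂≤1 {u} {v} {w} {x} h with adj u v | adj w x
  ... | true  | true  = ⊥-elim (h (_ , _))
  ... | true  | false = s≤s z≤n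
  ... | false | true  = s≤s z≤n
  ... | false | false = z≤n

  nbrs : Fin n → List (Fin n) → ℕ
  nbrs u l = sum (map (ind u) l)

  nbrs-++ : ∀ u xs ys → nbrs u (xs ++ ys) ≡ nbrs u xs + nbrs u ys
  nbrs-++ u xs ys = trans (cong sum (map-++ (ind u) xs ys)) (sum-++ (map (ind u) xs) _)

  nbrs-↭ : ∀ u {xs ys} → xs ↭ ys → nbrs u xs ≡ nbrs u ys
  nbrs-↭ u p = sum-↭ (map⁺ (ind u) p)

  nbrs₂≤length : ∀ {u v} zs → (∀ {z} → z ∈ zs → ¬ (u ~ z × v ~ z)) → nbrs u zs + nbrs v zs ≤ length zs
  nbrs₂≤length []  h = z≤n
  nbrs₂≤length {u} {v} (z ∷ zs) h = begin
      (ind u z + nbrs u zs) + (ind v z + nbrs v zs)  ≡⟨ +-interchange (ind u z) _ _ _ ⟩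
      (ind u z + ind v z) + (nbrs u zs + nbrs v zs)
        ≤⟨ +-mono-≤ (ind₂≤1 (h (here refl))) (nbrs₂≤length zs (λ i → h (there i))) ⟩
      suc (length zs) ∎
    where open ≤-Reasoning
          +-interchange : ∀ a b c e → (a + b) + (c + e) ≡ (a + c) + (b + e)
          +-interchange = solve-∀

  nonedge : Fin n → Fin n → ℕ
  nonedge u v = if adj u v then 0 else 1

  nonedge-sym : ∀ u v → nonedge u v ≡ nonedge v u
  nonedge-sym u v = cong (if_then 0 else 1) (adj-sym u v)

  nonedge≡0 : ∀ {u v} → u ~ v → nonedge u v ≡ 0
  nonedge≡0 {u} {v} a with adj u v
  ... | true = refl

  nonedge≡1 : ∀ {u v} → ¬ u ~ v → nonedge u v ≡ 1
  nonedge≡1 {u} {v} a with adj u v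
  ... | true  = ⊥-elim (a _)
  ... | false = refl

  -- The number of steps that are not edges of G; together with the closing step it is the measure
  -- that the exchange lowers.
  cost : List (Fin n) → ℕ
  cost []          = 0
  cost (u ∷ [])    = 0
  cost (u ∷ v ∷ l) = nonedge u v + cost (v ∷ l)

  cost-++ : ∀ {R S : Fin n → Fin n → Set} {a xs b c ys e} → Path R a xs b → Path S c ys e →
            cost (xs ++ ys) ≡ cost xs + (nonedge b c + cost ys)
  cost-++ (stop a) (stop c) = refl
  cost-++ (stop a) (_ ∷ _)  = refl
  cost-++ {R} (_∷_ {a} {b} r (stop _)) q =
    trans (cong (nonedge a b +_) (cost-++ {R} (stop b) q)) (cong (_+ _) (sym (+-identityʳ (nonedge a b))))
  cost-++ (_∷_ {a} {b} r p@(_ ∷ _)) q =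
    trans (cong (nonedge a b +_) (cost-++ p q)) (sym (+-assoc (nonedge a b) _ _))

  cost-reverse : ∀ {a l b} → Path _≈_ a l b → cost (reverse l) ≡ cost l
  cost-reverse (stop a) = refl
  cost-reverse (_∷_ {a} {b} {l} r p) = begin
      cost (reverse (a ∷ l))                          ≡⟨ cong cost (unfold-reverse a l) ⟩
      cost (reverse l ++ [ a ])                       ≡⟨ cost-++ (reversePath ≈-sym p) (stop {R = _≈_} a) ⟩
      cost (reverse l) + (nonedge b a + 0)            ≡⟨ cong₂ (λ x y → x + (y + 0)) (cost-reverse p) (nonedge-sym b a) ⟩
      cost l + (nonedge a b + 0)                      ≡⟨ cong (cost l +_) (+-identityʳ _) ⟩
      cost l + nonedge a b                            ≡⟨ +-comm (cost l) _ ⟩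
      nonedge a b + cost l                            ≡⟨ sym (head-cost p) ⟩
      cost (a ∷ l) ∎
    where
    open ≡-Reasoning
    head-cost : ∀ {b l c} → Path _≈_ b l c → cost (a ∷ l) ≡ nonedge a b + cost l
    head-cost (stop _) = refl
    head-cost (_ ∷ _)  = refl

  -- With `covers-heavy` as a field, maximality is among the cycles through all heavy vertices only,
  -- and every vertex off a cycle is light.
  record Cycle (R : Fin n → Fin n → Set) (l : List (Fin n)) : Set where
    field
      {first last} : Fin n
      path         : Path R first l last
      closing      : R last first
      unique       : Unique l
      covers-heavy : ∀ {v} → Heavy v → v ∈ l
      length≥3     : 3 ≤ length l

  open Cycle

  permute : ∀ {R S l l′} → Cycle R l → l ↭ l′ → ∀ {a b} → Path S a l′ b → S b a → Cycle S l′
  permute c p q r = record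
    { path         = q
    ; closing      = r
    ; unique       = Unique-↭ p (unique c)
    ; covers-heavy = λ h → ∈-resp-↭ p (covers-heavy c h)
    ; length≥3     = subst (3 ≤_) (↭-length p) (length≥3 c)
    }

  -- Without a crossing, each step from p to q contributes at most 1 to the count of `u ~ q` and
  -- `v ~ p`. There is one step fewer than vertices, and the first vertex for u and the last for v
  -- belong to no such pair.
  crossing : ∀ u v {a l b} → Path _≈_ a l b →
    (∃ λ xs → ∃ λ ys → ∃ λ p → ∃ λ q → l ≡ xs ++ ys × Path _≈_ a xs p × Path _≈_ q ys b × u ~ q × v ~ p)
    ⊎ nbrs u l + nbrs v l + 1 ≤ length l + (ind u a + ind v b)
  crossing u v (stop a) = inj₂ (≤-reflexive (arith (ind u a) (ind v a)))
    where arith : ∀ x y → x + 0 + (y + 0) + 1 ≡ 1 + (x + y)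
          arith = solve-∀
  crossing u v {b = b} (_∷_ {a} {q} {l} r p) with (u ~? q) ×-dec (v ~? a)
  ... | yes (uq , va) = inj₁ ([ a ] , l , a , q , refl , stop a , p , uq , va)
  ... | no h with crossing u v p
  ...   | inj₁ (xs , ys , p′ , q′ , refl , p₁ , p₂ , uq , vp) =
          inj₁ (a ∷ xs , ys , p′ , q′ , refl , r ∷ p₁ , p₂ , uq , vp)
  ...   | inj₂ bound = inj₂ (begin
      (ind u a + nbrs u l) + (ind v a + nbrs v l) + 1  ≡⟨ arith₁ (ind u a) (nbrs u l) (ind v a) _ ⟩
      ind u a + ind v a + (nbrs u l + nbrs v l + 1)    ≤⟨ +-monoʳ-≤ (ind u a + ind v a) bound ⟩
      ind u a + ind v a + (length l + (ind u q + ind v b)) ≡⟨ arith₂ (ind u a) (ind v a) (length l) (ind u q) _ ⟩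
      (ind u q + ind v a) + (length l + (ind u a + ind v b)) ≤⟨ +-monoˡ-≤ _ (ind₂≤1 h) ⟩
      suc (length l) + (ind u a + ind v b) ∎)
    where
    open ≤-Reasoning
    arith₁ : ∀ x y z w → (x + y) + (z + w) + 1 ≡ x + z + (y + w + 1)
    arith₁ = solve-∀
    arith₂ : ∀ x y z w t → x + y + (z + (w + t)) ≡ (w + y) + (z + (x + t))
    arith₂ = solve-∀

  real-or-nonedge : ∀ {a l b} → Path _≈_ a l b → Path _~_ a l b ⊎
    (∃ λ xs → ∃ λ ys → ∃ λ p → ∃ λ q → l ≡ xs ++ ys × Path _≈_ a xs p × Path _≈_ q ys b × p ≈ q × ¬ p ~ q)
  real-or-nonedge (stop a) = inj₁ (stop a)
  real-or-nonedge (_∷_ {a} {q} {l} r p) with a ~? q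
  ... | no h  = inj₂ ([ a ] , l , a , q , refl , stop a , p , r , h)
  ... | yes s with real-or-nonedge p
  ...   | inj₁ p′ = inj₁ (s ∷ p′)
  ...   | inj₂ (xs , ys , p′ , q′ , refl , p₁ , rest) =
          inj₂ (a ∷ xs , ys , p′ , q′ , refl , r ∷ p₁ , rest)

  module Maximal (m : ℕ) (maximal : ∀ {l} → Cycle _≈_ l → m < length l → ⊥) where

    total : ∀ {R l} → Cycle R l → ℕ
    total {l = l} c = cost l + nonedge (last c) (first c)

    -- The Bondy–Chvátal exchange: on a longest cycle, the ends of a nonedge of degree sum ≥ n
    -- have no common neighbour outside, so the path joining them has a crossing.
    exchange : ∀ {l} (c : Cycle _≈_ l) → length l ≡ m → ¬ last c ~ first c →
               ∃ λ l′ → Σ (Cycle _≈_ l′) λ c′ → length l′ ≡ m × total c′ < total c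
    exchange {l} c len≡m b≁a with complement (unique c)
    ... | zs , perm = by-crossing
      where
      a b : Fin n
      a = first c
      b = last c

      uniq : Unique (l ++ zs)
      uniq = Unique-↭ perm (allFin⁺ n)

      no-common : ∀ {z} → z ∈ zs → ¬ (a ~ z × b ~ z)
      no-common {z} z∈ (az , bz) = maximal longer (subst₂ _<_ len≡m (sym len) (n<1+n _))
        where
        len : length (l ++ [ z ]) ≡ suc (length l)
        len = trans (length-++ l) (+-comm (length l) 1)
        longer : Cycle _≈_ (l ++ [ z ])
        longer = record
          { path         = path c ++⟨ inj₁ bz ⟩ stop z
          ; closing      = inj₁ (~-sym az)
          ; unique       = Unique-↭ (++-comm [ z ] l)
                             (All.¬Any⇒All¬ l (λ z∈l → Unique-disjoint l uniq z∈l z∈) ∷ unique c)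
          ; covers-heavy = λ h → ∈-++⁺ˡ (covers-heavy c h)
          ; length≥3     = ≤-trans (length≥3 c) (≤-trans (n≤1+n _) (≤-reflexive (sym len)))
          }

      heavy-pair : n ≤ d a + d b
      heavy-pair with closing c
      ... | inj₁ e = ⊥-elim (b≁a e)
      ... | inj₂ h = subst (n ≤_) (+-comm (d b) (d a)) h

      too-few : ¬ nbrs a l + nbrs b l + 1 ≤ length l + (ind a a + ind b b)
      too-few bound = <-irrefl refl (begin-strict
          d a + d b ≡⟨ cong₂ _+_ (trans (nbrs-↭ a perm) (nbrs-++ a l zs)) (trans (nbrs-↭ b perm) (nbrs-++ b l zs)) ⟩
          (nbrs a l + nbrs a zs) + (nbrs b l + nbrs b zs) ≡⟨ arith (nbrs a l) _ _ _ ⟩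
          (nbrs a l + nbrs b l) + (nbrs a zs + nbrs b zs) <⟨ +-mono-<-≤ bound′ (nbrs₂≤length zs no-common) ⟩
          length l + length zs ≡⟨ length-++ l ⟨
          length (l ++ zs) ≡⟨ ↭-length perm ⟨
          length (allFin n) ≡⟨ length-allFin ⟩
          n ≤⟨ heavy-pair ⟩
          d a + d b ∎)
        where
        open ≤-Reasoning
        arith : ∀ x y z w → (x + y) + (z + w) ≡ (x + z) + (y + w)
        arith = solve-∀
        bound′ : nbrs a l + nbrs b l < length l
        bound′ = subst₂ _≤_ (+-comm _ 1)
          (trans (cong (length l +_) (cong₂ _+_ (ind-self a) (ind-self b))) (+-identityʳ _)) bound

      by-crossing : ∃ λ l′ → Σ (Cycle _≈_ l′) λ c′ → length l′ ≡ m × total c′ < total c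
      by-crossing with crossing a b (path c)
      ... | inj₂ bound = ⊥-elim (too-few bound)
      -- The new cycle is a ... p b ... q: the steps p q and b a give way to the edges p b and q a,
      -- so at least the nonedge b a is saved.
      ... | inj₁ (xs , ys , p , q , refl , p₁ , p₂ , aq , bp) =
        xs ++ reverse ys , c′ , trans (sym (↭-length perm′)) len≡m , (begin-strict
          cost (xs ++ reverse ys) + nonedge q a ≡⟨ cong₂ _+_ (cost-++ p₁ (reversePath ≈-sym p₂)) (nonedge≡0 (~-sym aq)) ⟩
          cost xs + (nonedge p b + cost (reverse ys)) + 0 ≡⟨ +-identityʳ _ ⟩
          cost xs + (nonedge p b + cost (reverse ys)) ≡⟨ cong₂ (λ i j → cost xs + (i + j)) (nonedge≡0 (~-sym bp)) (cost-reverse p₂) ⟩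
          cost xs + cost ys ≤⟨ +-monoʳ-≤ (cost xs) (m≤n+m _ (nonedge p q)) ⟩
          cost xs + (nonedge p q + cost ys) ≡⟨ cost-++ p₁ p₂ ⟨
          cost (xs ++ ys) <⟨ ≤-reflexive (+-comm 1 _) ⟩
          cost (xs ++ ys) + 1 ≡⟨ cong (cost (xs ++ ys) +_) (nonedge≡1 b≁a) ⟨
          cost (xs ++ ys) + nonedge b a ∎)
        where
        open ≤-Reasoning
        perm′ : xs ++ ys ↭ xs ++ reverse ys
        perm′ = ++⁺ˡ xs (↭-sym (↭-reverse ys))
        c′ : Cycle _≈_ (xs ++ reverse ys)
        c′ = permute c perm′ (p₁ ++⟨ inj₁ (~-sym bp) ⟩ reversePath ≈-sym p₂) (inj₁ (~-sym aq))

    -- Rotating the cycle brings any nonedge to the closing position and keeps `total`; there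
    -- `exchange` lowers `total`. The process ends at a cycle of G of the same length.
    realise : (∀ {l} → Cycle _~_ l → length l ≡ m → ⊥) →
              ∀ {l} (c : Cycle _≈_ l) → length l ≡ m → Acc _<_ (total c) → ⊥
    realise real {l} c len (acc rec) with real-or-nonedge (path c)
    ... | inj₂ (xs , ys , p , q , refl , p₁ , p₂ , pq , p≁q) =
        let rotated = permute c (++-comm xs ys) (p₂ ++⟨ closing c ⟩ p₁) pq
            l′ , c′ , len′ , lt = exchange rotated (trans (↭-length (++-comm ys xs)) len) p≁q
        in realise real c′ len′ (rec (<-≤-trans lt (≤-reflexive same-total)))
      where
      a b : Fin n
      a = first c
      b = last c
      arith : ∀ x y z w → y + (w + x) + z ≡ x + (z + y) + w
      arith = solve-∀
      same-total : cost (ys ++ xs) + nonedge p q ≡ cost (xs ++ ys) + nonedge b a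
      same-total = begin
          cost (ys ++ xs) + nonedge p q                     ≡⟨ cong (_+ nonedge p q) (cost-++ p₂ p₁) ⟩
          cost ys + (nonedge b a + cost xs) + nonedge p q   ≡⟨ arith (cost xs) (cost ys) (nonedge p q) _ ⟩
          cost xs + (nonedge p q + cost ys) + nonedge b a   ≡⟨ cong (_+ nonedge b a) (cost-++ p₁ p₂) ⟨
          cost (xs ++ ys) + nonedge b a ∎
        where open ≡-Reasoning
    ... | inj₁ p with last c ~? first c
    ...   | yes e = real (permute c ↭-refl p e) len
    ...   | no ¬e = let l′ , c′ , len′ , lt = exchange c len ¬e in realise real c′ len′ (rec lt)

-- A first cycle through the heavy vertices

module Start {n : ℕ} (G : Graph n) (2-connected : TwoConnected G) where
  open Heaviness G
  open import Data.List.Membership.DecPropositional (_≟_ {n}) using (_∈?_)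

  walk⇒path : ∀ {u v} ws → Walk G (u ∷ ws ++ [ v ]) → Path _~_ u (u ∷ ws ++ [ v ]) v
  walk⇒path []       (walk-∷ a _) = a ∷ stop _
  walk⇒path (w ∷ ws) (walk-∷ a p) = a ∷ walk⇒path ws p

  fresh : ∀ l → length l < n → ∃ λ v → v ∉ l
  fresh l short = ¬∀⟶∃¬ n (_∈ l) (_∈? l) λ all →
    let zs , p = Unique-⊆-↭ (allFin⁺ n) (λ {v} _ → all v) in
    <-irrefl refl (begin-strict
      length l                         <⟨ short ⟩
      n                                ≡⟨ length-allFin ⟨
      length (allFin n)                ≤⟨ m≤m+n _ _ ⟩
      length (allFin n) + length zs    ≡⟨ length-++ (allFin n) ⟨
      length (allFin n ++ zs)          ≡⟨ ↭-length p ⟨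
      length l ∎)
    where open ≤-Reasoning

  -- A path from a to a third vertex that avoids b has a suitable first step.
  neighbour-avoiding : ∀ a b → a ≢ b → ∃ λ c → a ~ c × c ≢ b
  neighbour-avoiding a b a≢b with fresh (a ∷ b ∷ []) (proj₁ 2-connected)
  ... | v , v∉ with proj₂ (proj₂ 2-connected) b a v a≢b (λ v≡b → v∉ (there (here v≡b)))
  ...   | []     , walk-∷ r _ , _ ∷ c≢b ∷ _ = _ , r , c≢b
  ...   | _ ∷ _ , walk-∷ r _ , _ ∷ c≢b ∷ _ = _ , r , c≢b

  -- Take a neighbour c of a other than b, and a path from c to b avoiding a; it closes up through a
  -- by the edge a c and the relation of b and a. As c differs from b, there are three vertices.
  cycle-through : ∀ a b → a ≢ b → a ≈ b → (∀ {v} → Heavy v → v ∈ a ∷ b ∷ []) → ∃ λ l → Cycle _≈_ l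
  cycle-through a b a≢b a≈b heavies with neighbour-avoiding a b a≢b
  ... | c , a~c , c≢b with proj₂ (proj₂ 2-connected) a c b (λ { refl → ~-irrefl a~c }) (λ { refl → a≢b refl })
  ...   | ws , w , avoids with erase-loops G (walk⇒path ws w)
  ...     | l , p , u , sub = a ∷ l , record
      { path         = inj₁ a~c ∷ mapPath inj₁ p
      ; closing      = ≈-sym a≈b
      ; unique       = All.¬Any⇒All¬ l (λ a∈l → All.lookup avoids (sub a∈l) refl) ∷ u
      ; covers-heavy = cover
      ; length≥3     = s≤s (two p)
      }
    where
    two : ∀ {l} → Path _~_ c l b → 2 ≤ length l
    two (stop _)         = ⊥-elim (c≢b refl)
    two (_ ∷ stop _)     = s≤s (s≤s z≤n)
    two (_ ∷ _ ∷ _)      = s≤s (s≤s z≤n)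
    cover : ∀ {v} → Heavy v → v ∈ a ∷ l
    cover h with heavies h
    ... | here refl         = here refl
    ... | there (here refl) = let k , eq = lastOf p in there (subst (b ∈_) (sym eq) (∈-++⁺ʳ k (here refl)))

  cycle-through₁ : ∀ a → (∀ {v} → Heavy v → v ∈ [ a ]) → ∃ λ l → Cycle _≈_ l
  cycle-through₁ a heavies with fresh [ a ] (≤-trans (n≤1+n _) (proj₁ 2-connected))
  ... | v , v∉ with neighbour-avoiding a v (λ { refl → v∉ (here refl) })
  ...   | b , a~b , _ = cycle-through a b (λ { refl → ~-irrefl a~b }) (inj₁ a~b)
                          (λ h → ∈-++⁺ˡ (heavies h))

  -- Three or more heavy vertices form an ≈-clique and thus a cycle by themselves; for fewer,
  -- 2-connectedness supplies the other vertices.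
  initial-cycle : ∃ λ l → Cycle _≈_ l
  initial-cycle = go (filter heavy? (allFin n)) refl
    where
    go : ∀ hs → hs ≡ filter heavy? (allFin n) → ∃ λ l → Cycle _≈_ l
    go hs hs≡ = cases hs (subst Unique (sym hs≡) (filter⁺ heavy? (allFin⁺ n)))
        (λ {v} h → subst (v ∈_) (sym hs≡) (∈-filter⁺ heavy? (∈-allFin v) h))
        (λ {v} i → proj₂ (∈-filter⁻ heavy? {xs = allFin n} (subst (v ∈_) hs≡ i)))
      where
      cases : ∀ hs → Unique hs → (∀ {v} → Heavy v → v ∈ hs) → (∀ {v} → v ∈ hs → Heavy v) → ∃ λ l → Cycle _≈_ l
      cases [] u all heavy = cycle-through₁ (proj₁ a) (λ h → ⊥-elim (¬Any[] (all h)))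
        where a = fresh [] (≤-trans (s≤s z≤n) (proj₁ 2-connected))
      cases (a ∷ []) u all heavy = cycle-through₁ a all
      cases (a ∷ b ∷ []) ((a≢b ∷ _) ∷ _) all heavy =
        cycle-through a b a≢b (inj₂ (heavy-sum a b (heavy (here refl)) (heavy (there (here refl))))) all
      cases hs@(a ∷ _ ∷ _ ∷ _) u all heavy =
        let w , p = clique-path u (λ {x} {y} i j _ → inj₂ (heavy-sum x y (heavy i) (heavy j)))
            k , eq = lastOf p
        in hs , record
          { path         = p
          ; closing      = inj₂ (heavy-sum w a (heavy (subst (w ∈_) (sym eq) (∈-++⁺ʳ k (here refl)))) (heavy (here refl)))
          ; unique       = u
          ; covers-heavy = all
          ; length≥3     = s≤s (s≤s (s≤s z≤n))
          }

-- Rerouting a maximal cycle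

module CM {A : Set} = CommutativeMonoidSolver (++-commutativeMonoid {A = A})

module Surgery {n : ℕ} (G : Graph n) (claw-o-heavy : ClawOHeavy G)
  {C : List (Fin n)} (cycle : Heaviness.Cycle G (Adj G) C)
  (maximal : ∀ {l} → Heaviness.Cycle G (Heaviness._≈_ G) l → length C < length l → ⊥) where
  open Heaviness G
  open Cycle using (unique; covers-heavy; length≥3)

  -- The rerouted cycle takes in `P` and gives up only `M`. If `M` is shorter and holds no heavy
  -- vertex, this is a longer admissible cycle.
  close : ∀ {a l b} M P → Path _≈_ a l b → b ≈ a → Unique (C ++ P) → l ++ M ↭ C ++ P →
          length M < length P → (∀ {v} → v ∈ M → ¬ Heavy v) → ⊥
  close {l = l} M P p r u perm M<P light = maximal longer C<l
    where
    C<l : length C < length l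
    C<l = +-cancelʳ-< (length M) _ _ (begin-strict
        length C + length M <⟨ +-monoʳ-< (length C) M<P ⟩
        length C + length P ≡⟨ length-++ C ⟨
        length (C ++ P)     ≡⟨ ↭-length perm ⟨
        length (l ++ M)     ≡⟨ length-++ l ⟩
        length l + length M ∎)
      where open ≤-Reasoning
    cover : ∀ {v} → Heavy v → v ∈ l
    cover h with ∈-++⁻ l (∈-resp-↭ (↭-sym perm) (∈-++⁺ˡ (covers-heavy cycle h)))
    ... | inj₁ i = i
    ... | inj₂ j = ⊥-elim (light j h)
    longer : Cycle _≈_ l
    longer = record
      { path         = p
      ; closing      = r
      ; unique       = Unique-++⁻ˡ l (Unique-↭ (↭-sym perm) u)
      ; covers-heavy = cover
      ; length≥3     = ≤-trans (length≥3 cycle) (<⇒≤ C<l)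
      }

  close₀ : ∀ {a l b} P → Path _≈_ a l b → b ≈ a → Unique (C ++ P) → l ↭ C ++ P → 0 < length P → ⊥
  close₀ {l = l} P p r u perm P>0 = close [] P p r u (↭-trans (↭-reflexive (++-identityʳ l)) perm) P>0 λ ()

  outside-light : ∀ {P v} → Unique (C ++ P) → v ∈ P → ¬ Heavy v
  outside-light u v∈P h = Unique-disjoint C u (covers-heavy cycle h) v∈P

  -- If a and b are not adjacent, then a, b, z are the leaves of an induced claw at c, and the pair
  -- of large degree sum cannot contain z.
  claw-≈ : ∀ {c a b z} → c ~ a → c ~ b → c ~ z → a ≢ b → a ≢ z → b ≢ z → ¬ a ≈ z → ¬ b ≈ z → a ≈ b
  claw-≈ {c} {a} {b} {z} ca cb cz a≢b a≢z b≢z a≉z b≉z with a ~? b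
  ... | yes e = inj₁ e
  ... | no ¬e with claw-o-heavy c a b z
        (ca , cb , cz , ¬e , (λ e → a≉z (inj₁ e)) , (λ e → b≉z (inj₁ e)) , a≢b , a≢z , b≢z)
  ...   | inj₁ h        = inj₂ h
  ...   | inj₂ (inj₁ h) = ⊥-elim (a≉z (inj₂ h))
  ...   | inj₂ (inj₂ h) = ⊥-elim (b≉z (inj₂ h))

  -- The cycle C read as x₁ S₁ x₂ S₂ with both arcs nonempty; fᵢ and tᵢ are the first and last
  -- vertices of Sᵢ. The edges fix the cyclic order, so `around` only has to compare vertex sets.
  record Frame : Set where
    field
      x₁ f₁ t₁ x₂ f₂ t₂ : Fin n
      S₁ S₂  : List (Fin n)
      path₁  : Path _~_ f₁ S₁ t₁
      path₂  : Path _~_ f₂ S₂ t₂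
      x₁~f₁  : x₁ ~ f₁
      t₁~x₂  : t₁ ~ x₂
      x₂~f₂  : x₂ ~ f₂
      t₂~x₁  : t₂ ~ x₁
      around : x₁ ∷ S₁ ++ x₂ ∷ S₂ ↭ C

  -- The orientation is kept, so a result about x₁ and S₁ applied to the swapped frame is the same
  -- result about x₂ and S₂.
  swap : Frame → Frame
  swap F = record
    { path₁ = path₂ ; path₂ = path₁ ; x₁~f₁ = x₂~f₂ ; t₁~x₂ = t₂~x₁ ; x₂~f₂ = x₁~f₁ ; t₂~x₁ = t₁~x₂
    ; around = ↭-trans (++-comm (x₂ ∷ S₂) (x₁ ∷ S₁)) around }
    where open Frame F

  -- Both relations occur: the induced six-vertex paths need a bridge of edges, while the one built
  -- from common neighbours is only an ≈-path.
  record Bridge (R : Fin n → Fin n → Set) (x y : Fin n) (P : List (Fin n)) : Set where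
    field
      {p q}   : Fin n
      path    : Path R p P q
      x∼p     : R x p
      q∼y     : R q y
      outside : Unique (C ++ P)

  swapBridge : ∀ {R} → Symmetric R → ∀ {x y P} → Bridge R x y P → Bridge R y x (reverse P)
  swapBridge s {P = P} B = record
    { path = reversePath s path ; x∼p = s q∼y ; q∼y = s x∼p
    ; outside = Unique-↭ (++⁺ˡ C (↭-sym (↭-reverse P))) outside }
    where open Bridge B

  mapBridge : ∀ {R S : Fin n → Fin n → Set} → (∀ {u v} → R u v → S u v) → ∀ {x y P} → Bridge R x y P → Bridge S x y P
  mapBridge f B = record { path = mapPath f path ; x∼p = f x∼p ; q∼y = f q∼y ; outside = outside }
    where open Bridge B

  path-nonempty : ∀ {R : Fin n → Fin n → Set} {a l b} → Path R a l b → 0 < length l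
  path-nonempty (stop _) = s≤s z≤n
  path-nonempty (_ ∷ _)  = s≤s z≤n

  module Arcs (F : Frame) where
    open Frame F

    -- Otherwise `Q` could be inserted between x₁ and its successor f₁. In `at-last` the vertex z
    -- would fit between the predecessor t₂ and x₁.
    at-first : ∀ {p Q z} → Path _≈_ p Q z → x₁ ≈ p → Unique (C ++ Q) → ¬ z ≈ f₁
    at-first {Q = Q} q x₁p u z≈f₁ =
      close₀ Q (inj₁ (~-sym t₂~x₁) ∷ reversePath ≈-sym (mapPath inj₁ path₂) ++⟨ inj₁ (~-sym x₂~f₂) ⟩
                inj₁ (~-sym t₁~x₂) ∷ reversePath ≈-sym (mapPath inj₁ path₁) ++⟨ ≈-sym z≈f₁ ⟩
                reversePath ≈-sym q)
             (≈-sym x₁p) u perm (path-nonempty q)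
      where
      open CM
      perm : x₁ ∷ reverse S₂ ++ x₂ ∷ reverse S₁ ++ reverse Q ↭ C ++ Q
      perm = ↭-trans (prep x₁ (++⁺ (↭-reverse S₂) (prep x₂ (++⁺ (↭-reverse S₁) (↭-reverse Q)))))
        (↭-trans (solve 5 (λ a b s t q → a ⊕ s ⊕ b ⊕ t ⊕ q ⊜ (a ⊕ t ⊕ b ⊕ s) ⊕ q) ↭-refl [ x₁ ] [ x₂ ] S₂ S₁ Q)
                 (++⁺ʳ Q around))

    at-last : ∀ {z} → x₁ ≈ z → Unique (C ++ [ z ]) → ¬ z ≈ t₂
    at-last {z} x₁z u z≈t₂ =
      close₀ [ z ] (≈-sym x₁z ∷ inj₁ x₁~f₁ ∷ mapPath inj₁ path₁ ++⟨ inj₁ t₁~x₂ ⟩ inj₁ x₂~f₂ ∷ mapPath inj₁ path₂)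
             (≈-sym z≈t₂) u (↭-trans (++-comm [ z ] _) (++⁺ʳ [ z ] around)) (s≤s z≤n)

    around-unique : Unique (x₁ ∷ S₁ ++ x₂ ∷ S₂)
    around-unique = Unique-↭ (↭-sym around) (unique cycle)

    f₁∈S₁ : f₁ ∈ S₁
    f₁∈S₁ with S₁ | path₁
    ... | _ | stop _ = here refl
    ... | _ | _ ∷ _  = here refl

    f₁∈C : f₁ ∈ C
    f₁∈C = ∈-resp-↭ around (there (∈-++⁺ˡ f₁∈S₁))

    t₂∈S₂ : t₂ ∈ S₂
    t₂∈S₂ with lastOf path₂
    ... | k , eq = subst (t₂ ∈_) (sym eq) (∈-++⁺ʳ k (here refl))

    t₂∈C : t₂ ∈ C
    t₂∈C = ∈-resp-↭ around (there (∈-++⁺ʳ S₁ (there t₂∈S₂)))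

    -- By maximality z is unrelated to both cycle neighbours of x₁, so `claw-≈` at x₁ relates these
    -- two. A cycle may then skip the old place of x₁.
    bypass : ∀ {z} → x₁ ~ z → Unique (C ++ [ z ]) → t₂ ≈ f₁
    bypass {z} x₁z u = claw-≈ (~-sym t₂~x₁) x₁~f₁ x₁z
      (λ t₂≡f₁ → Unique-disjoint (x₁ ∷ S₁) around-unique (there f₁∈S₁) (there (subst (_∈ S₂) t₂≡f₁ t₂∈S₂)))
      (λ t₂≡z → Unique-disjoint C u t₂∈C (here t₂≡z))
      (λ f₁≡z → Unique-disjoint C u f₁∈C (here f₁≡z))
      (λ e → at-last (inj₁ x₁z) u (≈-sym e))
      (λ e → at-first (stop z) (inj₁ x₁z) u (≈-sym e))

    -- The vertices of S₁ in front of which x₁ can be placed: either v is f₁, or the predecessor of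
    -- v is an ≈-neighbour of x₁.
    record Good (v : Fin n) : Set where
      field
        {U V} : List (Fin n)
        ends  : EndsIn (x₁ ≈_) U
        split : S₁ ≡ U ++ v ∷ V

    -- Once x₁ is bypassed, it can be put back after any of its ≈-neighbours on S₁.
    arm : t₂ ≈ f₁ → ∀ {U} X → EndsIn (x₁ ≈_) U → S₁ ≡ U ++ X →
          ∃ λ e → ∃ λ l → Path _≈_ e l x₁ × t₂ ≈ e × l ↭ x₁ ∷ U
    arm by X [] eq = x₁ , [ x₁ ] , stop x₁ , inj₁ t₂~x₁ , ↭-refl
    arm by X (snoc L {a} x₁≈a) eq =
      f₁ , _ , mapPath inj₁ (prefixPath L (subst (λ l → Path _~_ f₁ l t₁) (trans eq (++-assoc L [ a ] X)) path₁))
                 ++⟨ ≈-sym x₁≈a ⟩ stop x₁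
         , by , ++-comm (L ++ [ a ]) [ x₁ ]

    tail-path : ∀ U {v V} → S₁ ≡ U ++ v ∷ V → Path _≈_ v (v ∷ V) t₁
    tail-path U eq = mapPath inj₁ (suffixPath U (subst (λ l → Path _~_ f₁ l t₁) eq path₁))

    -- Place x₁ behind `U` and x₂ in front of `W`. The cycle through `U`, x₁, `P`, x₂, `W` and S₂
    -- trades `M` for `P`, so `M` cannot be shorter.
    gap : t₂ ≈ f₁ → t₁ ≈ f₂ → ∀ {P} → Bridge _≈_ x₁ x₂ P →
          ∀ U M W → S₁ ≡ U ++ M ++ W → EndsIn (x₁ ≈_) U → StartsIn (x₂ ≈_) W →
          (∀ {v} → v ∈ M → ¬ Heavy v) → length P ≤ length M
    gap by₁ by₂ {P} B U M W eq ends starts light = ≮⇒≥ λ M<P →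
      let e , l , p , t₂≈e , l↭ = arm by₁ (M ++ W) ends eq
          e′ , p′ , e′≈f₂       = right W starts eq
      in close M P (p ++⟨ x∼p ⟩ path ++⟨ q∼y ⟩ p′ ++⟨ e′≈f₂ ⟩ mapPath inj₁ path₂) t₂≈e outside (perm l↭) M<P light
      where
      open Bridge B
      -- After x₂ comes `W` up to t₁, and the step from t₁ to f₂ skips the old place of x₂; if `W`
      -- is empty, x₂ has not moved.
      right : ∀ W → StartsIn (x₂ ≈_) W → S₁ ≡ U ++ M ++ W → ∃ λ e′ → Path _≈_ x₂ (x₂ ∷ W) e′ × e′ ≈ f₂
      right []      []            eq = x₂ , stop x₂ , inj₁ x₂~f₂
      right (v ∷ W) (cons x₂≈v _) eq = t₁ , x₂≈v ∷ tail-path (U ++ M) (trans eq (sym (++-assoc U M (v ∷ W)))) , by₂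
      open CM
      perm : ∀ {l} → l ↭ x₁ ∷ U → (l ++ P ++ (x₂ ∷ W) ++ S₂) ++ M ↭ C ++ P
      perm l↭ = ↭-trans (++⁺ʳ M (++⁺ʳ _ l↭))
        (↭-trans (solve 7 (λ a u p b w s m → ((a ⊕ u) ⊕ p ⊕ (b ⊕ w) ⊕ s) ⊕ m ⊜ (a ⊕ (u ⊕ m ⊕ w) ⊕ b ⊕ s) ⊕ p) ↭-refl
                   [ x₁ ] U P [ x₂ ] W S₂ M)
        (++⁺ʳ P (subst (λ s → x₁ ∷ s ++ x₂ ∷ S₂ ↭ C) eq around)))

    -- The case of `gap` with nothing skipped, impossible since a bridge is nonempty.
    tight : t₂ ≈ f₁ → t₁ ≈ f₂ → ∀ {P} → Bridge _≈_ x₁ x₂ P →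
            ∀ U W → S₁ ≡ U ++ W → EndsIn (x₁ ≈_) U → StartsIn (x₂ ≈_) W → ⊥
    tight by₁ by₂ B U W eq ends starts =
      <-irrefl refl (<-≤-trans (path-nonempty (Bridge.path B)) (gap by₁ by₂ B U [] W eq ends starts λ ()))

    good≉x₂ : t₂ ≈ f₁ → t₁ ≈ f₂ → ∀ {P} → Bridge _≈_ x₁ x₂ P → ∀ {v} → Good v → ¬ v ≈ x₂
    good≉x₂ by₁ by₂ B g v≈x₂ = tight by₁ by₂ B U _ split ends (cons (≈-sym v≈x₂) V)
      where open Good g

    x₁≉t₁ : t₂ ≈ f₁ → t₁ ≈ f₂ → ∀ {P} → Bridge _≈_ x₁ x₂ P → ¬ x₁ ≈ t₁
    x₁≉t₁ by₁ by₂ B x₁≈t₁ with lastOf path₁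
    ... | k , eq = tight by₁ by₂ B (k ++ [ t₁ ]) [] (trans eq (sym (++-identityʳ _))) (snoc k x₁≈t₁) []

    -- With x₁ placed in front of v, the path `Q` would fit between x₁ and v.
    good≉outside : t₂ ≈ f₁ → ∀ {v} → Good v →
                   ∀ {p Q z} → Path _≈_ p Q z → x₁ ≈ p → Unique (C ++ Q) → ¬ v ≈ z
    good≉outside by {v} g {Q = Q} q x₁p u v≈z =
      let e , l , p , t₂≈e , l↭ = arm by (v ∷ V) ends split in
      close₀ Q (p ++⟨ x₁p ⟩ q ++⟨ ≈-sym v≈z ⟩ tail-path U split ++⟨ inj₁ t₁~x₂ ⟩ inj₁ x₂~f₂ ∷ mapPath inj₁ path₂)
             t₂≈e u (perm l↭) (path-nonempty q)
      where
      open Good g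
      open CM
      perm : ∀ {l} → l ↭ x₁ ∷ U → l ++ Q ++ (v ∷ V) ++ x₂ ∷ S₂ ↭ C ++ Q
      perm l↭ = ↭-trans (++⁺ʳ _ l↭)
        (↭-trans (solve 5 (λ a u q t s → (a ⊕ u) ⊕ q ⊕ t ⊕ s ⊜ (a ⊕ (u ⊕ t) ⊕ s) ⊕ q) ↭-refl
                   [ x₁ ] U Q (v ∷ V) (x₂ ∷ S₂))
        (++⁺ʳ Q (subst (λ s → x₁ ∷ s ++ x₂ ∷ S₂ ↭ C) split around)))

    record Break : Set where
      field
        {w y}  : Fin n
        good-w : Good w
        good-y : Good y
        x₁~w   : x₁ ~ w
        w~y    : w ~ y
        x₁≁y   : ¬ x₁ ~ y

    -- Follow S₁ from f₁ as long as its vertices are neighbours of x₁; this stops at t₁ at the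
    -- latest. The last neighbour w is good because its predecessor is x₁ or another neighbour of
    -- x₁, and y because its predecessor is w.
    first-break : ¬ x₁ ~ t₁ → Break
    first-break x₁≁t₁ = start path₁ refl
      where
      scan : ∀ U {f V} → S₁ ≡ U ++ f ∷ V → EndsIn (x₁ ≈_) U → x₁ ~ f → Path _~_ f (f ∷ V) t₁ → Break
      scan U eq e x₁~f (stop _) = ⊥-elim (x₁≁t₁ x₁~f)
      scan U {f} eq e x₁~f (_∷_ {b = g} f~g p) with headOf p
      ... | V , refl with trans eq (sym (++-assoc U [ f ] (g ∷ V))) | x₁ ~? g
      ...   | eq′ | yes x₁~g = scan (U ++ [ f ]) eq′ (snoc U (inj₁ x₁~f)) x₁~g p
      ...   | eq′ | no x₁≁g  = record
        { good-w = record { ends = e ; split = eq }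
        ; good-y = record { ends = snoc U (inj₁ x₁~f) ; split = eq′ }
        ; x₁~w = x₁~f ; w~y = f~g ; x₁≁y = x₁≁g }
      start : ∀ {l} → Path _~_ f₁ l t₁ → S₁ ≡ l → Break
      start p eq with headOf p
      ... | V , refl = scan [] eq [] x₁~f₁ p

  module _ (F : Frame) where
    open Frame F
    private
      module A₁ = Arcs F
      module A₂ = Arcs (swap F)

    -- Place x₁ in front of v and x₂ in front of v′. With the relation of v and v′ a longer cycle
    -- arises: the part of S₁ before v, x₁, `P`, x₂, the part of S₂ before v′ backwards, then from
    -- t₁ back to v, and from v′ on to t₂.
    good≉good : t₂ ≈ f₁ → t₁ ≈ f₂ → ∀ {P} → Bridge _≈_ x₁ x₂ P → ∀ {v v′} → A₁.Good v → A₂.Good v′ → ¬ v ≈ v′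
    good≉good by₁ by₂ {P} B {v} {v′} g g′ v≈v′ =
      let e₁ , l₁ , p₁ , t₂≈e₁ , l₁↭ = A₁.arm by₁ (v ∷ G₁.V) G₁.ends G₁.split
          e₂ , l₂ , p₂ , t₁≈e₂ , l₂↭ = A₂.arm by₂ (v′ ∷ G₂.V) G₂.ends G₂.split
      in close₀ P
           (p₁ ++⟨ x∼p ⟩ path ++⟨ q∼y ⟩ reversePath ≈-sym p₂ ++⟨ ≈-sym t₁≈e₂ ⟩
            reversePath ≈-sym (A₁.tail-path G₁.U G₁.split) ++⟨ v≈v′ ⟩ A₂.tail-path G₂.U G₂.split)
           t₂≈e₁ outside (perm l₁↭ l₂↭) (path-nonempty path)
      where
      module G₁ = A₁.Good g
      module G₂ = A₂.Good g′
      open Bridge B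
      open CM
      perm : ∀ {l₁ l₂} → l₁ ↭ x₁ ∷ G₁.U → l₂ ↭ x₂ ∷ G₂.U →
             l₁ ++ P ++ reverse l₂ ++ reverse (v ∷ G₁.V) ++ (v′ ∷ G₂.V) ↭ C ++ P
      perm {l₂ = l₂} l₁↭ l₂↭ =
        ↭-trans (++⁺ l₁↭ (++⁺ˡ P (++⁺ (↭-trans (↭-reverse l₂) l₂↭) (++⁺ʳ (v′ ∷ G₂.V) (↭-reverse (v ∷ G₁.V))))))
        (↭-trans (solve 7 (λ a u p b w t s → (a ⊕ u) ⊕ p ⊕ (b ⊕ w) ⊕ t ⊕ s ⊜ (a ⊕ (u ⊕ t) ⊕ b ⊕ (w ⊕ s)) ⊕ p) ↭-refl
                   [ x₁ ] G₁.U P [ x₂ ] G₂.U (v ∷ G₁.V) (v′ ∷ G₂.V))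
        (++⁺ʳ P (subst₂ (λ s t → x₁ ∷ s ++ x₂ ∷ t ↭ C) G₁.split G₂.split around)))

-- Induced six-vertex paths

module SixPaths {n : ℕ} (G : Graph n)
  (p6 : (v : Fin 6 → Fin n) → InducedP6 G v →
        Σ (Fin 6) λ i → Σ (Fin 6) λ j → toℕ i < 3 × 3 ≤ toℕ j × n ≤ degree G (v i) + degree G (v j)) where
  open Heaviness G

  Consecutive : Fin 6 → Fin 6 → Set
  Consecutive i j = toℕ j ≡ suc (toℕ i) ⊎ toℕ i ≡ suc (toℕ j)

  consecutive? : ∀ i j → Dec (Consecutive i j)
  consecutive? i j = (toℕ j ℕ.≟ suc (toℕ i)) ⊎-dec (toℕ i ℕ.≟ suc (toℕ j))

  Separates : Fin 6 → Fin 6 → Fin 6 → Set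
  Separates i j k = (Consecutive i k × ¬ Consecutive j k) ⊎ (¬ Consecutive i k × Consecutive j k)

  -- The path on six vertices has no twins, so injectivity of an induced P₆ is automatic.
  no-twins : ∀ i j → i ≢ j → ∃ (Separates i j)
  no-twins = from-yes (all? λ i → all? λ j → ¬? (i ≟ j) →-dec any? λ k →
    (consecutive? i k ×-dec ¬? (consecutive? j k)) ⊎-dec (¬? (consecutive? i k) ×-dec consecutive? j k))

  -- In the applications v₀ v₁ v₂ are y₁ w₁ x₁. A negated ≈ supplies a nonedge of the induced path
  -- and also rules the pair out for the degree condition, which leaves only the pairs with v₂.
  six-path : ∀ {v₀ v₁ v₂ v₃ v₄ v₅} →
    v₀ ~ v₁ → v₁ ~ v₂ → v₂ ~ v₃ → v₃ ~ v₄ → v₄ ~ v₅ →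
    ¬ v₀ ~ v₂ → ¬ v₂ ~ v₄ → ¬ v₂ ~ v₅ → ¬ v₃ ~ v₅ →
    ¬ v₀ ≈ v₃ → ¬ v₀ ≈ v₄ → ¬ v₀ ≈ v₅ → ¬ v₁ ≈ v₃ → ¬ v₁ ≈ v₄ → ¬ v₁ ≈ v₅ →
    n ≤ d v₂ + d v₃ ⊎ n ≤ d v₂ + d v₄ ⊎ n ≤ d v₂ + d v₅
  six-path {v₀} {v₁} {v₂} {v₃} {v₄} {v₅} e₀₁ e₁₂ e₂₃ e₃₄ e₄₅ n₀₂ n₂₄ n₂₅ n₃₅ h₀₃ h₀₄ h₀₅ h₁₃ h₁₄ h₁₅ =
      conclude (p6 v (injective , λ i j → adjacency i j))
    where
    v : Fin 6 → Fin n
    v = lookup (v₀ ∷ v₁ ∷ v₂ ∷ v₃ ∷ v₄ ∷ v₅ ∷ [])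

    -- At literal indices this computes to an edge or a nonedge, so `upper` can list the entries
    -- directly.
    Entry : Fin 6 → Fin 6 → Set
    Entry i j = if does (consecutive? i j) then v i ~ v j else ¬ v i ~ v j

    upper : ∀ i j → toℕ i < toℕ j → Entry i j
    upper _  0F ()
    upper 0F 1F _ = e₀₁
    upper (suc _) 1F (s≤s ())
    upper 0F 2F _ = n₀₂
    upper 1F 2F _ = e₁₂
    upper (suc (suc _)) 2F (s≤s (s≤s ()))
    upper 0F 3F _ = λ e → h₀₃ (inj₁ e)
    upper 1F 3F _ = λ e → h₁₃ (inj₁ e)
    upper 2F 3F _ = e₂₃
    upper (suc (suc (suc _))) 3F (s≤s (s≤s (s≤s ())))
    upper 0F 4F _ = λ e → h₀₄ (inj₁ e)
    upper 1F 4F _ = λ e → h₁₄ (inj₁ e)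
    upper 2F 4F _ = n₂₄
    upper 3F 4F _ = e₃₄
    upper (suc (suc (suc (suc _)))) 4F (s≤s (s≤s (s≤s (s≤s ()))))
    upper 0F 5F _ = λ e → h₀₅ (inj₁ e)
    upper 1F 5F _ = λ e → h₁₅ (inj₁ e)
    upper 2F 5F _ = n₂₅
    upper 3F 5F _ = n₃₅
    upper 4F 5F _ = e₄₅
    upper 5F 5F (s≤s (s≤s (s≤s (s≤s (s≤s ())))))

    decided : ∀ {P A : Set} (c : Dec P) → (if does c then A else ¬ A) → A ⇔ P
    decided (yes c) a  = mk⇔ (λ _ → c) (λ _ → a)
    decided (no ¬c) ¬a = mk⇔ (λ a → ⊥-elim (¬a a)) (λ c → ⊥-elim (¬c c))

    adjacency : ∀ i j → Adj G (v i) (v j) ⇔ Consecutive i j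
    adjacency i j with <-cmp i j
    ... | tri< i<j _ _ = decided (consecutive? i j) (upper i j i<j)
    ... | tri> _ _ j<i = let open Equivalence (decided (consecutive? j i) (upper j i j<i)) in
                         mk⇔ (λ a → Sum.swap (to (~-sym a))) (λ c → ~-sym (from (Sum.swap c)))
    ... | tri≈ _ refl _ = mk⇔ (λ a → ⊥-elim (~-irrefl a))
      (λ { (inj₁ e) → ⊥-elim (<-irrefl e (n<1+n _)) ; (inj₂ e) → ⊥-elim (<-irrefl e (n<1+n _)) })

    injective : Injective _≡_ _≡_ v
    injective {i} {j} vi≡vj with i ≟ j
    ... | yes i≡j = i≡j
    ... | no i≢j with no-twins i j i≢j
    ...   | k , inj₁ (c , ¬c) = ⊥-elim (¬c (Equivalence.to (adjacency j k)
              (subst (λ x → Adj G x (v k)) vi≡vj (Equivalence.from (adjacency i k) c))))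
    ...   | k , inj₂ (¬c , c) = ⊥-elim (¬c (Equivalence.to (adjacency i k)
              (subst (λ x → Adj G x (v k)) (sym vi≡vj) (Equivalence.from (adjacency j k) c))))

    conclude : (Σ (Fin 6) λ i → Σ (Fin 6) λ j → toℕ i < 3 × 3 ≤ toℕ j × n ≤ d (v i) + d (v j)) →
               n ≤ d v₂ + d v₃ ⊎ n ≤ d v₂ + d v₄ ⊎ n ≤ d v₂ + d v₅
    conclude (0F , 3F , _ , _ , h) = ⊥-elim (h₀₃ (inj₂ h))
    conclude (0F , 4F , _ , _ , h) = ⊥-elim (h₀₄ (inj₂ h))
    conclude (0F , 5F , _ , _ , h) = ⊥-elim (h₀₅ (inj₂ h))
    conclude (1F , 3F , _ , _ , h) = ⊥-elim (h₁₃ (inj₂ h))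
    conclude (1F , 4F , _ , _ , h) = ⊥-elim (h₁₄ (inj₂ h))
    conclude (1F , 5F , _ , _ , h) = ⊥-elim (h₁₅ (inj₂ h))
    conclude (2F , 3F , _ , _ , h) = inj₁ h
    conclude (2F , 4F , _ , _ , h) = inj₂ (inj₁ h)
    conclude (2F , 5F , _ , _ , h) = inj₂ (inj₂ h)
    conclude (_ , 0F , _ , () , _)
    conclude (_ , 1F , _ , s≤s () , _)
    conclude (_ , 2F , _ , s≤s (s≤s ()) , _)
    conclude (suc (suc (suc _)) , _ , s≤s (s≤s (s≤s ())) , _)

-- Degrees of the ends of a shortest bridge

module Endgame {n : ℕ} (G : Graph n) (claw-o-heavy : ClawOHeavy G)
  (p6 : (v : Fin 6 → Fin n) → InducedP6 G v →
        Σ (Fin 6) λ i → Σ (Fin 6) λ j → toℕ i < 3 × 3 ≤ toℕ j × n ≤ degree G (v i) + degree G (v j))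
  {C : List (Fin n)} (cycle : Heaviness.Cycle G (Adj G) C)
  (maximal : ∀ {l} → Heaviness.Cycle G (Heaviness._≈_ G) l → length C < length l → ⊥) where
  open Heaviness G
  open SixPaths G p6
  open Surgery G claw-o-heavy cycle maximal

  take-outside : ∀ xs {ys} → Unique (C ++ xs ++ ys) → Unique (C ++ xs)
  take-outside xs {ys} u = Unique-++⁻ˡ (C ++ xs) (subst Unique (sym (++-assoc C xs ys)) u)

  drop-outside : ∀ xs {ys} → Unique (C ++ xs ++ ys) → Unique (C ++ ys)
  drop-outside xs {ys} u = Unique-++⁻ʳ xs (Unique-↭ (shifts C xs) u)

  Shortest : Fin n → Fin n → ℕ → Set
  Shortest x y k = ∀ {P} → Bridge _~_ x y P → k ≤ length P

  bypassed : (F : Frame) → let open Frame F in ∀ {P} → Bridge _~_ x₁ x₂ P → t₂ ≈ f₁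
  bypassed F B with headOf (Bridge.path B)
  ... | P , eq = Arcs.bypass F x∼p (take-outside [ p ] (subst (λ l → Unique (C ++ l)) eq outside))
    where open Bridge B

  module _ (F : Frame) where
    open Frame F
    private
      module A₁ = Arcs F
      module A₂ = Arcs (swap F)

    -- The six vertices start with y₁ w₁ x₁ and continue along the bridge, then with x₂ w₂ y₂ as far
    -- as needed. Chords within the bridge would shorten it, and the other nonedges come from
    -- rerouting. Vertices off C are light, so a large degree sum of x₁ with one of them makes x₁
    -- heavy.
    heavy-or-sum : ∀ {P} → Bridge _~_ x₁ x₂ P → Shortest x₁ x₂ (length P) → Heavy x₁ ⊎ n ≤ d x₁ + d x₂
    heavy-or-sum {P} B shortest = by-length path x∼p q∼y outside shortest (x₁ ~? x₂)
      where
      open Bridge B using (path; x∼p; q∼y; outside)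
      B≈ : Bridge _≈_ x₁ x₂ P
      B≈ = mapBridge inj₁ B
      B≈′ : Bridge _≈_ x₂ x₁ (reverse P)
      B≈′ = swapBridge ≈-sym B≈

      by₁ : t₂ ≈ f₁
      by₁ = bypassed F B
      by₂ : t₁ ≈ f₂
      by₂ = bypassed (swap F) (swapBridge ~-sym B)

      open A₁.Break (A₁.first-break (λ e → A₁.x₁≉t₁ by₁ by₂ B≈ (inj₁ e)))
        renaming (w to w₁; y to y₁; good-w to good-w₁; good-y to good-y₁; w~y to w₁~y₁; x₁≁y to x₁≁y₁; x₁~w to x₁~w₁)
      open A₂.Break (A₂.first-break (λ e → A₂.x₁≉t₁ by₂ by₁ B≈′ (inj₁ e)))
        renaming (w to w₂; y to y₂; good-w to good-w₂; good-y to good-y₂; w~y to w₂~y₂; x₁≁y to x₂≁y₂; x₁~w to x₂~w₂)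

      y₁≁x₁ : ¬ y₁ ~ x₁
      y₁≁x₁ e = x₁≁y₁ (~-sym e)

      opposite : ∀ {v} → A₂.Good v → ¬ x₁ ≈ v
      opposite g e = A₂.good≉x₂ by₂ by₁ B≈′ g (≈-sym e)

      far : ∀ {v} → A₁.Good v → ¬ v ≈ x₂
      far = A₁.good≉x₂ by₁ by₂ B≈

      across : ∀ {v v′} → A₁.Good v → A₂.Good v′ → ¬ v ≈ v′
      across = good≉good F by₁ by₂ B≈

      off : ∀ {v} → A₁.Good v → ∀ {p z} Q {R} → Path _~_ p Q z → x₁ ~ p → Unique (C ++ Q ++ R) → ¬ v ≈ z
      off g Q q x∼p u = A₁.good≉outside by₁ g (mapPath inj₁ q) (inj₁ x∼p) (take-outside Q u)

      light : ∀ {Q z} → Unique (C ++ Q) → z ∈ Q → n ≤ d x₁ + d z → Heavy x₁ ⊎ n ≤ d x₁ + d x₂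
      light u z∈Q h with heavy-end _ _ h
      ... | inj₁ hx = inj₁ hx
      ... | inj₂ hz = ⊥-elim (outside-light u z∈Q hz)

      too-short : ∀ {Q p q k} → Shortest x₁ x₂ k → Path _~_ p Q q → x₁ ~ p → q ~ x₂ → Unique (C ++ Q) →
                  length Q < k → ⊥
      too-short shortest q x∼p q∼y u lt =
        <⇒≱ lt (shortest record { path = q ; x∼p = x∼p ; q∼y = q∼y ; outside = u })

      by-length : ∀ {p q P} → Path _~_ p P q → x₁ ~ p → q ~ x₂ → Unique (C ++ P) → Shortest x₁ x₂ (length P) →
                  Dec (x₁ ~ x₂) → Heavy x₁ ⊎ n ≤ d x₁ + d x₂
      -- An edge between x₁ and x₂ replaces the bridge in the six-vertex path; the bridge still
      -- serves in the rerouting.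
      by-length _ _ _ _ _ (yes x₁~x₂) =
        Sum.[ (λ h → inj₂ h) , Sum.[ (λ h → ⊥-elim (opposite good-w₂ (inj₂ h))) , (λ h → ⊥-elim (opposite good-y₂ (inj₂ h))) ] ] (
        six-path (~-sym w₁~y₁) (~-sym x₁~w₁) x₁~x₂ x₂~w₂ w₂~y₂
          y₁≁x₁ (λ e → opposite good-w₂ (inj₁ e)) (λ e → opposite good-y₂ (inj₁ e)) x₂≁y₂
          (far good-y₁) (across good-y₁ good-w₂) (across good-y₁ good-y₂)
          (far good-w₁) (across good-w₁ good-w₂) (across good-w₁ good-y₂))
      by-length (stop z) x∼p q∼y u s (no x₁≁x₂) =
        Sum.[ (λ h → light u (here refl) h) , Sum.[ (λ h → inj₂ h) , (λ h → ⊥-elim (opposite good-w₂ (inj₂ h))) ] ] (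
        six-path (~-sym w₁~y₁) (~-sym x₁~w₁) x∼p q∼y x₂~w₂
          y₁≁x₁ x₁≁x₂ (λ e → opposite good-w₂ (inj₁ e)) z≁w₂
          (off good-y₁ [ z ] (stop z) x∼p u) (far good-y₁) (across good-y₁ good-w₂)
          (off good-w₁ [ z ] (stop z) x∼p u) (far good-w₁) (across good-w₁ good-w₂))
        where
        z≁w₂ : ¬ z ~ w₂
        z≁w₂ e = A₂.good≉outside by₂ good-w₂ (stop z) (inj₁ (~-sym q∼y)) u (inj₁ (~-sym e))
      by-length (_∷_ {z₁} z₁~z₂ (stop z₂)) x∼p q∼y u s (no x₁≁x₂) =
        Sum.[ (λ h → light u (here refl) h) , Sum.[ (λ h → light u (there (here refl)) h) , (λ h → inj₂ h) ] ] (
        six-path (~-sym w₁~y₁) (~-sym x₁~w₁) x∼p z₁~z₂ q∼y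
          y₁≁x₁ (λ e → too-short s (stop z₂) e q∼y (drop-outside [ z₁ ] u) ≤-refl) x₁≁x₂ z₁≁x₂
          (off good-y₁ [ z₁ ] (stop z₁) x∼p u) (off good-y₁ (z₁ ∷ z₂ ∷ []) (z₁~z₂ ∷ stop z₂) x∼p u) (far good-y₁)
          (off good-w₁ [ z₁ ] (stop z₁) x∼p u) (off good-w₁ (z₁ ∷ z₂ ∷ []) (z₁~z₂ ∷ stop z₂) x∼p u) (far good-w₁))
        where
        z₁≁x₂ : ¬ z₁ ~ x₂
        z₁≁x₂ e = too-short s (stop z₁) x∼p e (take-outside [ z₁ ] u) ≤-refl
      -- From three bridge vertices on, the path stops at z₃, so all pairs left join x₁ to a light
      -- vertex.
      by-length (_∷_ {z₁} z₁~z₂ (_∷_ {z₂} {z₃} z₂~z₃ p₃)) x∼p q∼y u s (no x₁≁x₂) with headOf p₃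
      ... | zs , refl =
        Sum.[ light u (here refl) , Sum.[ light u (there (here refl)) , light u (there (there (here refl))) ] ] (
        six-path (~-sym w₁~y₁) (~-sym x₁~w₁) x∼p z₁~z₂ z₂~z₃
          y₁≁x₁ (λ e → too-short s (z₂~z₃ ∷ p₃) e q∼y (drop-outside [ z₁ ] u) ≤-refl)
          (λ e → too-short s p₃ e q∼y (drop-outside (z₁ ∷ z₂ ∷ []) u) (n≤1+n _))
          (λ e → too-short s (e ∷ p₃) x∼p q∼y z₁z₃-outside ≤-refl)
          (off good-y₁ [ z₁ ] (stop z₁) x∼p u) (off good-y₁ (z₁ ∷ z₂ ∷ []) (z₁~z₂ ∷ stop z₂) x∼p u)
          (off good-y₁ (z₁ ∷ z₂ ∷ z₃ ∷ []) (z₁~z₂ ∷ z₂~z₃ ∷ stop z₃) x∼p u)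
          (off good-w₁ [ z₁ ] (stop z₁) x∼p u) (off good-w₁ (z₁ ∷ z₂ ∷ []) (z₁~z₂ ∷ stop z₂) x∼p u)
          (off good-w₁ (z₁ ∷ z₂ ∷ z₃ ∷ []) (z₁~z₂ ∷ z₂~z₃ ∷ stop z₃) x∼p u))
        where
        z₁z₃-outside : Unique (C ++ z₁ ∷ z₃ ∷ zs)
        z₁z₃-outside = drop-outside [ z₂ ] (Unique-↭ (++⁺ˡ C (_↭_.swap z₁ z₂ ↭-refl)) u)

  -- Reversing the bridge and swapping the frame gives the same alternative for x₂; if neither side
  -- yields the sum, both ends are heavy.
  heavy-ends : (F : Frame) → let open Frame F in ∀ {P} → Bridge _~_ x₁ x₂ P → Shortest x₁ x₂ (length P) →
               n ≤ d x₁ + d x₂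
  heavy-ends F {P} B shortest
    with heavy-or-sum F B shortest | heavy-or-sum (swap F) (swapBridge ~-sym B) shortest′
    where
    open Frame F
    shortest′ : Shortest x₂ x₁ (length (reverse P))
    shortest′ {Q} B′ = subst₂ _≤_ (sym (length-reverse P)) (length-reverse Q) (shortest (swapBridge ~-sym B′))
  ... | inj₂ h  | _       = h
  ... | inj₁ _  | inj₂ h  = subst (n ≤_) (+-comm (d (Frame.x₂ F)) _) h
  ... | inj₁ h₁ | inj₁ h₂ = heavy-sum _ _ h₁ h₂

-- Counting neighbours

module Counting {n : ℕ} (G : Graph n) (claw-o-heavy : ClawOHeavy G)
  {C : List (Fin n)} (cycle : Heaviness.Cycle G (Adj G) C)
  (maximal : ∀ {l} → Heaviness.Cycle G (Heaviness._≈_ G) l → length C < length l → ⊥) where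
  open Heaviness G
  open Surgery G claw-o-heavy cycle maximal

  module _ (u v : Fin n) where

    common? : Decidable (λ z → u ~ z × v ~ z)
    common? z = (u ~? z) ×-dec (v ~? z)

    both : Fin n → ℕ
    both z = ind u z + ind v z

    sum-both : ∀ zs → sum (map both zs) ≡ nbrs u zs + nbrs v zs
    sum-both []       = refl
    sum-both (z ∷ zs) = trans (cong (both z +_) (sum-both zs)) (arith (ind u z) (ind v z) _ _)
      where arith : ∀ x y s t → x + y + (s + t) ≡ (x + s) + (y + t)
            arith = solve-∀

    both≤common : ∀ zs → sum (map both zs) ≤ length zs + length (filter common? zs)
    both≤common []       = z≤n
    both≤common (z ∷ zs) with common? z
    ... | yes c = begin
        both z + sum (map both zs)                    ≤⟨ +-mono-≤ (+-mono-≤ (ind≤1 u z) (ind≤1 v z)) (both≤common zs) ⟩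
        2 + (length zs + length (filter common? zs))  ≡⟨ cong suc (+-suc (length zs) _) ⟨
        suc (length zs + suc (length (filter common? zs)))
          ≡⟨ cong (λ l → suc (length zs + length l)) (filter-accept common? {xs = zs} c) ⟨
        suc (length zs + length (filter common? (z ∷ zs))) ∎
      where open ≤-Reasoning
    ... | no ¬c = subst (λ l → both z + sum (map both zs) ≤ suc (length zs + length l))
                    (sym (filter-reject common? {xs = zs} ¬c))
                    (+-mono-≤ (ind₂≤1 ¬c) (both≤common zs))

  -- One of x₁ and x₂ is heavy and hence related to every heavy vertex. Vertices related to neither
  -- are therefore light, as `gap` asks of the skipped ones, and the count in `Gaps` applies.
  arc-bound : (F : Frame) → let open Frame F in t₂ ≈ f₁ → t₁ ≈ f₂ → n ≤ d x₁ + d x₂ →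
              ∀ {P} → Bridge _≈_ x₁ x₂ P → nbrs x₁ S₁ + nbrs x₂ S₁ + length P ≤ length S₁
  arc-bound F by₁ by₂ h {P} B = subst (λ s → s + length P ≤ length S₁) (sum-both x₁ x₂ S₁) weight-bound
    where
    open Frame F
    not-heavy : ∀ {v} → ¬ x₁ ≈ v × ¬ x₂ ≈ v → ¬ Heavy v
    not-heavy (x₁≉v , x₂≉v) hv with heavy-end x₁ x₂ h
    ... | inj₁ h₁ = x₁≉v (inj₂ (heavy-sum x₁ _ h₁ hv))
    ... | inj₂ h₂ = x₂≉v (inj₂ (heavy-sum x₂ _ h₂ hv))
    open Gaps (x₁ ≈?_) (x₂ ≈?_) (both x₁ x₂)
      (λ v → +-mono-≤ (ind≤1 x₁ v) (ind≤1 x₂ v))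
      (λ {v} x₁≉v → +-mono-≤ (ind≤0 (λ e → x₁≉v (inj₁ e))) (ind≤1 x₂ v))
      (λ {v} x₂≉v → +-mono-≤ (ind≤1 x₁ v) (ind≤0 (λ e → x₂≉v (inj₁ e))))
      (λ x₁≉v x₂≉v → +-mono-≤ (ind≤0 (λ e → x₁≉v (inj₁ e))) (ind≤0 (λ e → x₂≉v (inj₁ e))))
      (path-nonempty (Bridge.path B))
      (λ U M W eq ends starts free → Arcs.gap F by₁ by₂ B U M W eq ends starts
        (λ v∈M → not-heavy (All.lookup free v∈M)))

  module _ (F : Frame) {P} (B : Bridge _~_ (Frame.x₁ F) (Frame.x₂ F) P) where
    open Frame F

    private
      Out : List (Fin n)
      Out = proj₁ (complement (unique cycle))
        where open Cycle

      partition : allFin n ↭ C ++ Out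
      partition = proj₂ (complement (Cycle.unique cycle))

      partition-unique : Unique (C ++ Out)
      partition-unique = Unique-↭ partition (allFin⁺ n)

      W : List (Fin n)
      W = filter (common? x₁ x₂) Out

    -- The common neighbours of x₁ and x₂ outside C are pairwise ≈, for otherwise two of them
    -- and f₁ would be the leaves of a claw at x₁.  So they form a bridge of their own.
    wide-bridge : ∃ λ P′ → Bridge _≈_ x₁ x₂ P′ × length W ≤ length P′
    wide-bridge = go W refl
      where
      go : ∀ l → l ≡ W → ∃ λ P′ → Bridge _≈_ x₁ x₂ P′ × length l ≤ length P′
      -- Without common neighbours the given bridge serves: its positive length suffices for ω.
      go []      _  = P , mapBridge inj₁ B , z≤n
      go (w ∷ l) eq =
        let q , p   = clique-path (Unique-++⁻ʳ C W-outside) related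
            k , eq′ = lastOf p
        in w ∷ l , record
          { path = p ; x∼p = inj₁ (proj₁ (common (here refl)))
          ; q∼y = inj₁ (~-sym (proj₂ (common (subst (q ∈_) (sym eq′) (∈-++⁺ʳ k (here refl))))))
          ; outside = W-outside } , ≤-refl
        where
        in-filter : ∀ {z} → z ∈ w ∷ l → z ∈ Out × (x₁ ~ z × x₂ ~ z)
        in-filter z∈ = ∈-filter⁻ (common? x₁ x₂) {xs = Out} (subst (_ ∈_) eq z∈)
        common : ∀ {z} → z ∈ w ∷ l → x₁ ~ z × x₂ ~ z
        common z∈ = proj₂ (in-filter z∈)
        z∉C : ∀ {z} → z ∈ w ∷ l → z ∉ C
        z∉C z∈ z∈C = Unique-disjoint C partition-unique z∈C (proj₁ (in-filter z∈))
        W-outside : Unique (C ++ w ∷ l)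
        W-outside = Unique⁺.++⁺ (Cycle.unique cycle)
          (subst Unique (sym eq) (filter⁺ (common? x₁ x₂) (Unique-++⁻ʳ C partition-unique)))
          (λ (i , j) → z∉C j i)
        ≢f₁ : ∀ {z} → z ∈ w ∷ l → z ≢ f₁
        ≢f₁ z∈ refl = z∉C z∈ (Arcs.f₁∈C F)
        ≉f₁ : ∀ {z} → z ∈ w ∷ l → ¬ z ≈ f₁
        ≉f₁ z∈ = Arcs.at-first F (stop _) (inj₁ (proj₁ (common z∈)))
          (Unique⁺.++⁺ (Cycle.unique cycle) ([] ∷ []) λ { (i , here refl) → z∉C z∈ i })
        related : ∀ {a b} → a ∈ w ∷ l → b ∈ w ∷ l → a ≢ b → a ≈ b
        related i j a≢b = claw-≈ (proj₁ (common i)) (proj₁ (common j)) x₁~f₁ a≢b (≢f₁ i) (≢f₁ j) (≉f₁ i) (≉f₁ j)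

    -- Let ω be the length of the wide bridge. Each arc falls short of its length by ω, the outside
    -- exceeds its size by at most ω, and x₁ and x₂ contribute at most 2 to each other's degrees.
    -- The sum is at most n - ω; ω is added twice on the left to avoid subtraction.
    too-few-edges : t₂ ≈ f₁ → t₁ ≈ f₂ → ¬ n ≤ d x₁ + d x₂
    too-few-edges by₁ by₂ h with wide-bridge
    ... | P′ , B′ , W≤P′ = <-irrefl refl (<-≤-trans n<n+ω (+-cancelʳ-≤ ω (n + ω) n (begin
        n + ω + ω            ≤⟨ +-monoˡ-≤ ω (+-monoˡ-≤ ω h) ⟩
        d x₁ + d x₂ + ω + ω  ≡⟨ cong₂ (λ i j → i + j + ω + ω) (degree-sum x₁) (degree-sum x₂) ⟩
        (ind x₁ x₁ + (nbrs x₁ S₁ + (ind x₁ x₂ + nbrs x₁ S₂)) + nbrs x₁ Out) +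
        (ind x₂ x₁ + (nbrs x₂ S₁ + (ind x₂ x₂ + nbrs x₂ S₂)) + nbrs x₂ Out) + ω + ω
          ≡⟨ cong₂ (λ i j → (i + (nbrs x₁ S₁ + (ind x₁ x₂ + nbrs x₁ S₂)) + nbrs x₁ Out) +
                            (ind x₂ x₁ + (nbrs x₂ S₁ + (j + nbrs x₂ S₂)) + nbrs x₂ Out) + ω + ω)
                   (ind-self x₁) (ind-self x₂) ⟩
        (nbrs x₁ S₁ + (ind x₁ x₂ + nbrs x₁ S₂) + nbrs x₁ Out) +
        (ind x₂ x₁ + (nbrs x₂ S₁ + nbrs x₂ S₂) + nbrs x₂ Out) + ω + ω
          ≡⟨ regroup (nbrs x₁ S₁) (ind x₁ x₂) (nbrs x₁ S₂) (nbrs x₁ Out) (ind x₂ x₁) (nbrs x₂ S₁) (nbrs x₂ S₂) (nbrs x₂ Out) ω ⟩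
        (ind x₁ x₂ + ind x₂ x₁) + ((nbrs x₁ S₁ + nbrs x₂ S₁ + ω) + ((nbrs x₂ S₂ + nbrs x₁ S₂ + ω) + (nbrs x₁ Out + nbrs x₂ Out)))
          ≤⟨ +-mono-≤ (+-mono-≤ (ind≤1 x₁ x₂) (ind≤1 x₂ x₁))
               (+-mono-≤ (arc-bound F by₁ by₂ h B′)
               (+-mono-≤ (subst (λ k → nbrs x₂ S₂ + nbrs x₁ S₂ + k ≤ length S₂) (length-reverse P′)
                           (arc-bound (swap F) by₂ by₁ (subst (n ≤_) (+-comm (d x₁) _) h) (swapBridge ≈-sym B′)))
                         (≤-trans (subst (_≤ length Out + length W) (sum-both x₁ x₂ Out) (both≤common x₁ x₂ Out))
                                  (+-monoʳ-≤ (length Out) W≤P′)))) ⟩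
        2 + (length S₁ + (length S₂ + (length Out + ω))) ≡⟨ regroup′ (length S₁) (length S₂) (length Out) ω ⟩
        suc (length S₁ + suc (length S₂)) + length Out + ω ≡⟨ cong (_+ ω) order ⟨
        n + ω ∎)))
      where
      open ≤-Reasoning
      ω : ℕ
      ω = length P′
      n<n+ω : n < n + ω
      n<n+ω = subst (_≤ n + ω) (+-comm n 1) (+-monoʳ-≤ n (path-nonempty (Bridge.path B′)))
      whole : allFin n ↭ (x₁ ∷ S₁ ++ x₂ ∷ S₂) ++ Out
      whole = ↭-trans partition (++⁺ʳ Out (↭-sym around))
      degree-sum : ∀ v → d v ≡ ind v x₁ + (nbrs v S₁ + (ind v x₂ + nbrs v S₂)) + nbrs v Out
      degree-sum v = trans (nbrs-↭ v whole) (trans (nbrs-++ v (x₁ ∷ S₁ ++ x₂ ∷ S₂) Out)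
        (cong (λ k → ind v x₁ + k + nbrs v Out) (nbrs-++ v S₁ (x₂ ∷ S₂))))
      order : n ≡ suc (length S₁ + suc (length S₂)) + length Out
      order = trans (sym length-allFin) (trans (↭-length whole) (trans (length-++ (x₁ ∷ S₁ ++ x₂ ∷ S₂))
        (cong (λ k → suc k + length Out) (length-++ S₁))))
      regroup : ∀ a i b c j a′ b′ c′ w → (a + (i + b) + c) + (j + (a′ + b′) + c′) + w + w ≡
                (i + j) + ((a + a′ + w) + ((b′ + b + w) + (c + c′)))
      regroup = solve-∀
      regroup′ : ∀ a b c w → 2 + (a + (b + (c + w))) ≡ suc (a + suc b) + c + w
      regroup′ = solve-∀

-- From 2-connectedness to a bridge

module Framing {n : ℕ} (G : Graph n) (claw-o-heavy : ClawOHeavy G)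
  {C : List (Fin n)} (cycle : Heaviness.Cycle G (Adj G) C)
  (maximal : ∀ {l} → Heaviness.Cycle G (Heaviness._≈_ G) l → length C < length l → ⊥) where
  open Heaviness G
  open Surgery G claw-o-heavy cycle maximal
  open import Data.List.Membership.DecPropositional (_≟_ {n}) using (_∈?_)

  rotate : ∀ {x} → x ∈ C → ∃ λ l → ∃ λ t → Path _~_ x (x ∷ l) t × t ~ x × x ∷ l ↭ C
  rotate x∈C with ∈-∃++ x∈C
  ... | xs , ys , eq = go xs (subst (λ l → Path _~_ first l last) eq path)
                             (λ {k} r → ↭-trans r (↭-reflexive (sym eq)))
    where
    open Cycle cycle
    go : ∀ {x ys} xs → Path _~_ first (xs ++ x ∷ ys) last → (∀ {k} → k ↭ xs ++ x ∷ ys → k ↭ C) →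
         ∃ λ l → ∃ λ t → Path _~_ x (x ∷ l) t × t ~ x × x ∷ l ↭ C
    go {x} {ys} [] p to-C with headOf p
    ... | _ , refl = ys , last , p , closing , to-C ↭-refl
    go {x} {ys} (y ∷ xs) p to-C =
      let c , p₁ , r , p₂ = splitPath xs p
      in ys ++ y ∷ xs , c , p₂ ++⟨ closing ⟩ p₁ , r , to-C (++-comm (x ∷ ys) (y ∷ xs))

  -- An empty arc would mean that x₁ and x₂ are consecutive on C, and the bridge could be inserted
  -- between them.
  with-frame : ∀ {x₁ x₂ P} → x₁ ∈ C → x₂ ∈ C → x₁ ≢ x₂ → Bridge _~_ x₁ x₂ P →
               ((F : Frame) → Frame.x₁ F ≡ x₁ → Frame.x₂ F ≡ x₂ → ⊥) → ⊥
  with-frame {x₁} {x₂} {P} x₁∈C x₂∈C x₁≢x₂ B k with rotate x₁∈C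
  ... | l , t , p , t~x₁ , l↭C with ∈-resp-↭ (↭-sym l↭C) x₂∈C
  ...   | here refl = x₁≢x₂ refl
  ...   | there x₂∈l with ∈-∃++ x₂∈l
  ...     | S₁ , S₂ , refl = arcs S₁ S₂ p l↭C
    where
    open Bridge B hiding (p)
    arcs : ∀ S₁ S₂ → Path _~_ x₁ (x₁ ∷ S₁ ++ x₂ ∷ S₂) t → x₁ ∷ S₁ ++ x₂ ∷ S₂ ↭ C → ⊥
    arcs [] S₂ p ↭C =
      let _ , _ , _ , p₂ = splitPath [] p
      in close₀ P (inj₁ x∼p ∷ mapPath inj₁ path ++⟨ inj₁ q∼y ⟩ mapPath inj₁ p₂) (inj₁ t~x₁) outside
           (↭-trans (prep x₁ (++-comm P (x₂ ∷ S₂))) (++⁺ʳ P ↭C)) (path-nonempty path)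
    arcs (f ∷ S₁) S₂ (x₁~f ∷ p) ↭C with headOf p
    ... | _ , refl with splitPath S₁ p
    ...   | c , p₁ , c~x₂ , stop _ =
      close₀ P (inj₁ x₁~f ∷ mapPath inj₁ p₁ ++⟨ inj₁ c~x₂ ⟩ stop x₂ ++⟨ inj₁ (~-sym q∼y) ⟩
                reversePath ≈-sym (mapPath inj₁ path))
             (inj₁ (~-sym x∼p)) outside
             (↭-trans (↭-trans (++⁺ˡ (x₁ ∷ f ∷ S₁) (prep x₂ (↭-reverse P)))
                               (↭-reflexive (sym (++-assoc (x₁ ∷ f ∷ S₁) [ x₂ ] P))))
                      (++⁺ʳ P ↭C))
             (path-nonempty path)
    ...   | c , p₁ , c~x₂ , x₂~g ∷ p₂ = k record
      { path₁ = p₁ ; path₂ = p₂ ; x₁~f₁ = x₁~f ; t₁~x₂ = c~x₂ ; x₂~f₂ = x₂~g ; t₂~x₁ = t~x₁ ; around = ↭C }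
      refl refl

  -- `Q` transports a property of all vertices of the path, such as differing from x₁, to the vertex
  -- where C is met.
  first-hit : ∀ {u l v} {Q : Fin n → Set} → Path _~_ u l v → (∀ {w} → w ∈ l → Q w) → u ∉ C → v ∈ C →
              ∃ λ P → ∃ λ q → ∃ λ x → Path _~_ u P q × (∀ {w} → w ∈ P → w ∉ C) × q ~ x × x ∈ C × Q x
  first-hit (stop _) Q u∉C v∈C = ⊥-elim (u∉C v∈C)
  first-hit (_∷_ {u} {b} r p) Q u∉C v∈C with b ∈? C
  ... | yes b∈C with headOf p
  ...   | _ , refl = [ u ] , u , b , stop u , (λ { (here refl) → u∉C }) , r , b∈C , Q (there (here refl))
  first-hit (_∷_ {u} {b} r p) Q u∉C v∈C | no b∉C with first-hit p (λ i → Q (there i)) b∉C v∈C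
  ...   | P , q , x , p′ , avoid , rest =
          u ∷ P , q , x , r ∷ p′ , (λ { (here refl) → u∉C ; (there i) → avoid i }) , rest

  other : ∀ x → ∃ λ y → y ∈ C × y ≢ x
  other x = go C (unique cycle) (length≥3 cycle)
    where
    open Cycle
    go : ∀ l → Unique l → 3 ≤ length l → ∃ λ y → y ∈ l × y ≢ x
    go (_ ∷ []) _ (s≤s ())
    go (a ∷ b ∷ _) ((a≢b ∷ _) ∷ _) _ with a ≟ x
    ... | yes refl = b , there (here refl) , λ b≡a → a≢b (sym b≡a)
    ... | no a≢x   = a , here refl , a≢x

  -- A path from the missed vertex first meets C in x₁, coming from some z off C. A path from z to C
  -- that avoids x₁ then meets C first in some other vertex x₂.
  bridge : TwoConnected G → ∀ {z} → z ∉ C →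
           ∃ λ x₁ → ∃ λ x₂ → x₁ ∈ C × x₂ ∈ C × x₁ ≢ x₂ × ∃ (Bridge _~_ x₁ x₂)
  bridge 2c@(_ , connected , 2-connected) {z₀} z₀∉C with other z₀
  ... | y , y∈C , _ with connected z₀ y
  ...   | ws , w with first-hit (Start.walk⇒path G 2c ws w) (λ _ → refl {x = z₀}) z₀∉C y∈C
  ...     | P , z , x₁ , p , avoid , z~x₁ , x₁∈C , _ with other x₁ | avoid (last∈ p)
    where
    last∈ : ∀ {R : Fin n → Fin n → Set} {a l b} → Path R a l b → b ∈ l
    last∈ p = let k , eq = lastOf p in subst (_ ∈_) (sym eq) (∈-++⁺ʳ k (here refl))
  ...       | c , c∈C , c≢x₁ | z∉C with 2-connected x₁ z c (λ { refl → z∉C x₁∈C }) c≢x₁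
  ...         | ws′ , w′ , avoids with first-hit (Start.walk⇒path G 2c ws′ w′) (All.lookup avoids) z∉C c∈C
  ...           | P′ , q , x₂ , p′ , avoid′ , q~x₂ , x₂∈C , x₂≢x₁ with erase-loops G p′
  ...             | P″ , p″ , u″ , sub = x₁ , x₂ , x₁∈C , x₂∈C , (λ e → x₂≢x₁ (sym e)) , P″ , record
    { path = p″ ; x∼p = ~-sym z~x₁ ; q∼y = q~x₂
    ; outside = Unique⁺.++⁺ (Cycle.unique cycle) u″ (λ (i , j) → avoid′ (sub j) i) }

-- From a spanning cycle to hamiltonicity, and the two inductions for maximality and shortness

module _ {n : ℕ} {G : Graph n} where
  open Heaviness G

  path⇒walk : ∀ {a l b c} → Path _~_ a l b → b ~ c → Walk G (l ++ [ c ])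
  path⇒walk (stop _)          s = walk-∷ s walk-[ _ ]
  path⇒walk (r ∷ p@(stop _))  s = walk-∷ r (path⇒walk p s)
  path⇒walk (r ∷ p@(_ ∷ _))   s = walk-∷ r (path⇒walk p s)

  spanning⇒hamiltonian : ∀ {l} → Cycle _~_ l → (∀ v → v ∈ l) → Hamiltonian G
  spanning⇒hamiltonian c spans = let k , eq = headOf path in first , k ,
    subst (λ l → 3 ≤ length l × Unique l × (∀ v → v ∈ l) × Walk G (l ++ [ first ])) eq
      (length≥3 , unique , spans , path⇒walk path closing)
    where open Cycle c

theorem7 : (n : ℕ) (G : Graph n) → TwoConnected G → ClawOHeavy G →
    ((v : Fin 6 → Fin n) → InducedP6 G v →
    Σ (Fin 6) λ i → Σ (Fin 6) λ j →
    toℕ i < 3 × 3 ≤ toℕ j × n ≤ degree G (v i) + degree G (v j)) →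
    Hamiltonian G
theorem7 n G 2-connected claw-o-heavy p6 = decidable-stable (hamiltonian? G) λ ¬ham →
  let l , c = Start.initial-cycle G 2-connected in no-cycle ¬ham c (<-wellFounded _)
  where
  open Heaviness G
  open import Data.List.Membership.DecPropositional (_≟_ {n}) using (_∈?_)

  module _ {C : List (Fin n)} (cycle : Cycle _~_ C) (maximal : ∀ {l} → Cycle _≈_ l → length C < length l → ⊥) where
    open Surgery G claw-o-heavy cycle maximal using (Frame; swap; Bridge; swapBridge)
    open Endgame G claw-o-heavy p6 cycle maximal using (bypassed; heavy-ends)
    open Counting G claw-o-heavy cycle maximal using (too-few-edges)
    open Framing G claw-o-heavy cycle maximal using (with-frame; bridge)

    -- Induction on the length replaces the choice of a shortest bridge: a shorter one between the
    -- same ends is already refuted, so the given one may be taken as shortest.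
    no-bridge : ∀ {x₁ x₂} → x₁ ∈ C → x₂ ∈ C → x₁ ≢ x₂ → ∀ {P} → Bridge _~_ x₁ x₂ P → Acc _<_ (length P) → ⊥
    no-bridge x₁∈C x₂∈C x₁≢x₂ B (acc rec) = with-frame x₁∈C x₂∈C x₁≢x₂ B λ { F refl refl →
      too-few-edges F B (bypassed F B) (bypassed (swap F) (swapBridge ~-sym B))
        (heavy-ends F B λ B′ → ≮⇒≥ λ shorter → no-bridge x₁∈C x₂∈C x₁≢x₂ B′ (rec shorter)) }

    spanning : ∀ v → v ∈ C
    spanning v with v ∈? C
    ... | yes v∈C = v∈C
    ... | no v∉C  = let _ , _ , x₁∈C , x₂∈C , x₁≢x₂ , _ , B = bridge 2-connected v∉C
                    in ⊥-elim (no-bridge x₁∈C x₂∈C x₁≢x₂ B (<-wellFounded _))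

  -- Induction on n minus the length replaces the choice of a longest cycle: longer cycles are
  -- already refuted, so this one is maximal.
  no-cycle : ¬ Hamiltonian G → ∀ {l} → Cycle _≈_ l → Acc _<_ (n ∸ length l) → ⊥
  no-cycle ¬ham {l} c (acc rec) = realise real c refl (<-wellFounded _)
    where
    maximal : ∀ {l′} → Cycle _≈_ l′ → length l < length l′ → ⊥
    maximal c′ longer = no-cycle ¬ham c′ (rec (∸-monoʳ-< longer (Unique⇒length≤n (Cycle.unique c′))))
    open Maximal (length l) maximal using (realise)
    real : ∀ {l′} → Cycle _~_ l′ → length l′ ≡ length l → ⊥
    real c′ eq = ¬ham (spanning⇒hamiltonian c′ (spanning c′ λ c″ lt → maximal c″ (subst (_< _) eq lt)))
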